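{- Let $k\ge 2$ be an integer and let $n\ge 2k$ be an integer. Then the adjacency spectrum of the line graph $L(BL_n(k-1,k))$ consists of exactly the following eigenvalues with the following multiplicities: \begin{itemize} \item $-2$, with multiplicity $k\binom{n}{k}-\binom{n+1}{k}+1$; \item $j-2$, for each $j=1,2,\ldots,k-1$, with multiplicity $\binom{n}{j}-\binom{n}{j-1}$; \item $n-1-j$, for each $j=0,1,\ldots,k-1$, with multiplicity $\binom{n}{j}-\binom{n}{j-1}$; \item $k-2$, with multiplicity $\binom{n}{k}-\binom{n}{k-1}$. \end{itemize}
   Context: Let $[n]=\{1,\ldots,n\}$. For $n\ge 3$, the Boolean lattice $BL_n$ is the graph whose vertices are all subsets of $[n]$, two subsets being adjacent if and only if their symmetric difference has exactly one element. $BL_n(k-1,k)$ is the induced subgraph of $BL_n$ on the set of all $(k-1)$-element subsets and all $k$-element subsets of $[n]$; that is, it is the bipartite graph in which a $(k-1)$-subset $U$ is adjacent to a $k$-subset $W$ if and only if $U\subset W$. The line graph $L(\Gamma)$ of a graph $\Gamma$ has as vertices the edges of $\Gamma$, two distinct edges being adjacent if and only if they share an endpoint. The spectrum of a graph is the multiset of eigenvalues of its adjacency matrix. Convention: $\binom{n}{ -1}=0$. -}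

module Defs where

open import Algebra.Bundles using (RawRing)
open import Data.Bool.Base using (Bool; true; false; if_then_else_)
import Data.Bool.Properties as Bool
open import Data.Fin.Base using (Fin; zero; suc; toℕ; punchIn)
import Data.Fin.Properties as Fin
open import Data.Fin.Subset using (Subset; ∣_∣; _─_; _∪_)
open import Data.Fin.Subset.Properties using (∪-comm)
open import Data.Integer.Base as ℤ using (ℤ; +_; -[1+_]; 0ℤ; 1ℤ)
open import Data.List.Base using (List; []; _∷_; [_]; _++_; map; foldr; filter; length; lookup)
open import Data.List.Membership.Propositional using (_∈_)
open import Data.List.Membership.Propositional.Properties using (∈-map⁺; ∈-map⁻; ∈-++⁺ˡ; ∈-++⁺ʳ)
open import Data.List.Relation.Unary.All as All using (All)
import Data.List.Relation.Unary.All.Properties as All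
import Data.List.Relation.Unary.AllPairs as AllPairs
open import Data.List.Relation.Unary.Any using (here)
open import Data.List.Relation.Unary.Unique.Propositional using (Unique)
import Data.List.Relation.Unary.Unique.Propositional.Properties as Unique
open import Data.Nat.Base as ℕ using (ℕ; zero; suc)
open import Data.Nat.Combinatorics using (_C_)
import Data.Nat.Properties as ℕ
open import Data.Product.Base using (_×_; _,_; proj₁; proj₂)
import Data.Product.Properties as Product
open import Data.Sum.Base using (_⊎_; inj₁; inj₂)
open import Data.Vec.Base as Vec using ([]; _∷_)
import Data.Vec.Properties as Vec
open import Function.Base using (_∘_)
open import Level using (0ℓ)
open import Relation.Binary.Core using (Rel)
open import Relation.Binary.Definitions
  using (DecidableEquality; Symmetric; Irreflexive) renaming (Decidable to Decidable₂)
open import Relation.Binary.PropositionalEquality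
  using (_≡_; _≢_; refl; sym; trans; cong; cong₂; subst)
open import Relation.Nullary using (¬_; does; _×-dec_; _⊎-dec_; ¬?)
open import Relation.Unary using (Pred; Decidable)

-- A finite simple graph.  Its vertices are the members of the list `vertices`;
-- the type V may contain further elements, which are not vertices.
record Graph : Set₁ where
  field
    V        : Set
    _≟_      : DecidableEquality V
    vertices : List V
    unique   : Unique vertices
    Adj      : Rel V 0ℓ
    adj?     : Decidable₂ Adj
    symm     : Symmetric Adj
    irrefl   : Irreflexive _≡_ Adj

induced : (G : Graph) {P : Pred (Graph.V G) 0ℓ} → Decidable P → Graph
induced G P? = record
  { V        = V
  ; _≟_      = _≟_
  ; vertices = filter P? vertices
  ; unique   = Unique.filter⁺ P? unique
  ; Adj      = Adj
  ; adj?     = adj?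
  ; symm     = symm
  ; irrefl   = irrefl
  }
  where open Graph G

-- All pairs (x , y) with x occurring before y.
pairs : {A : Set} → List A → List (A × A)
pairs []       = []
pairs (x ∷ xs) = map (x ,_) xs ++ pairs xs

private
  first∈ : {A : Set} (xs : List A) → All (λ p → proj₁ p ∈ xs) (pairs xs)
  first∈ []       = All.[]
  first∈ (x ∷ xs) =
    All.++⁺ (All.map⁺ (All.tabulate λ _ → here refl))
            (All.map (∈-++⁺ʳ [ x ]) (first∈ xs))

pairs-unique : {A : Set} {xs : List A} → Unique xs → Unique (pairs xs)
pairs-unique {xs = []}     AllPairs.[]              = AllPairs.[]
pairs-unique {xs = x ∷ xs} (x∉xs AllPairs.∷ xs!) =
  Unique.++⁺ (Unique.map⁺ Product.,-injectiveʳ xs!) (pairs-unique xs!) disjoint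
  where
  disjoint : ∀ {p} → ¬ (p ∈ map (x ,_) xs × p ∈ pairs xs)
  disjoint (p∈l , p∈r) with ∈-map⁻ (x ,_) p∈l
  ... | _ , _ , refl = All.lookup x∉xs (All.lookup (first∈ xs) p∈r) refl

-- The edge {u , v} is represented once, by the pair listing its endpoints in
-- the order in which they occur in `vertices`.
edges : (G : Graph) → List (Graph.V G × Graph.V G)
edges G = filter (λ (u , v) → adj? u v) (pairs vertices)
  where open Graph G

ShareEndpoint : {A : Set} → Rel (A × A) 0ℓ
ShareEndpoint (u , v) (u′ , v′) = (u ≡ u′ ⊎ u ≡ v′) ⊎ (v ≡ u′ ⊎ v ≡ v′)

lineGraph : Graph → Graph
lineGraph G = record
  { V        = V × V
  ; _≟_      = _≟ₑ_
  ; vertices = edges G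
  ; unique   = Unique.filter⁺ (λ (u , v) → adj? u v) (pairs-unique unique)
  ; Adj      = λ e f → e ≢ f × ShareEndpoint e f
  ; adj?     = λ e@(u , v) f@(u′ , v′) →
      ¬? (e ≟ₑ f) ×-dec (((u ≟ u′) ⊎-dec (u ≟ v′)) ⊎-dec ((v ≟ u′) ⊎-dec (v ≟ v′)))
  ; symm     = λ (e≢f , s) → e≢f ∘ sym , share-sym s
  ; irrefl   = λ e≡f (e≢f , _) → e≢f e≡f
  }
  where
  open Graph G
  _≟ₑ_ : DecidableEquality (V × V)
  _≟ₑ_ = Product.≡-dec _≟_ _≟_
  share-sym : Symmetric (ShareEndpoint {V})
  share-sym (inj₁ (inj₁ p)) = inj₁ (inj₁ (sym p))
  share-sym (inj₁ (inj₂ p)) = inj₂ (inj₁ (sym p))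
  share-sym (inj₂ (inj₁ p)) = inj₁ (inj₂ (sym p))
  share-sym (inj₂ (inj₂ p)) = inj₂ (inj₂ (sym p))

subsets : ∀ n → List (Subset n)
subsets zero    = [ [] ]
subsets (suc n) = map (false ∷_) (subsets n) ++ map (true ∷_) (subsets n)

subsets-complete : ∀ {n} (p : Subset n) → p ∈ subsets n
subsets-complete []                  = here refl
subsets-complete (false ∷ p)         = ∈-++⁺ˡ (∈-map⁺ (false ∷_) (subsets-complete p))
subsets-complete {suc n} (true ∷ p)  =
  ∈-++⁺ʳ (map (false ∷_) (subsets n)) (∈-map⁺ (true ∷_) (subsets-complete p))

subsets-unique : ∀ n → Unique (subsets n)
subsets-unique zero    = All.[] AllPairs.∷ AllPairs.[]
subsets-unique (suc n) =
  Unique.++⁺ (Unique.map⁺ Vec.∷-injectiveʳ (subsets-unique n))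
             (Unique.map⁺ Vec.∷-injectiveʳ (subsets-unique n)) disjoint
  where
  disjoint : ∀ {p} → ¬ (p ∈ map (false ∷_) (subsets n) × p ∈ map (true ∷_) (subsets n))
  disjoint (p∈l , p∈r) with ∈-map⁻ (false ∷_) p∈l | ∈-map⁻ (true ∷_) p∈r
  ... | _ , _ , refl | _ , _ , ()

infixl 6 _△_

_△_ : ∀ {n} → Subset n → Subset n → Subset n
p △ q = (p ─ q) ∪ (q ─ p)

∣p△p∣≡0 : ∀ {n} (p : Subset n) → ∣ p △ p ∣ ≡ 0
∣p△p∣≡0 []          = refl
∣p△p∣≡0 (false ∷ p) = ∣p△p∣≡0 p
∣p△p∣≡0 (true ∷ p)  = ∣p△p∣≡0 p

-- The Boolean lattice graph; the ground set [n] is Fin n.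
BL : ℕ → Graph
BL n = record
  { V        = Subset n
  ; _≟_      = Vec.≡-dec Bool._≟_
  ; vertices = subsets n
  ; unique   = subsets-unique n
  ; Adj      = λ p q → ∣ p △ q ∣ ≡ 1
  ; adj?     = λ p q → ∣ p △ q ∣ ℕ.≟ 1
  ; symm     = λ {p} {q} → trans (cong ∣_∣ (∪-comm (q ─ p) (p ─ q)))
  ; irrefl   = λ { {p} refl eq → ℕ.0≢1+n (trans (sym (∣p△p∣≡0 p)) eq) }
  }

-- BL_n(k-1,k).  The condition suc ∣ p ∣ ≡ k says ∣ p ∣ = k - 1 without
-- truncated subtraction.
BLlayers : ℕ → ℕ → Graph
BLlayers n k = induced (BL n) {λ p → suc ∣ p ∣ ≡ k ⊎ ∣ p ∣ ≡ k}
  (λ p → (suc ∣ p ∣ ℕ.≟ k) ⊎-dec (∣ p ∣ ℕ.≟ k))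

Matrix : Set → ℕ → Set
Matrix A m = Fin m → Fin m → A

adjacencyMatrix : (G : Graph) → Matrix ℤ (length (Graph.vertices G))
adjacencyMatrix G i j =
  if does (adj? (lookup vertices i) (lookup vertices j)) then 1ℤ else 0ℤ
  where open Graph G

module Determinant (R : RawRing 0ℓ 0ℓ) where
  open RawRing R
  open import Algebra.Definitions.RawSemiring rawSemiring using (sum; _^_)

  -- Laplace expansion along the first row.
  det : ∀ {m} → Matrix Carrier m → Carrier
  det {zero}  M = 1#
  det {suc m} M =
    sum λ j → (- 1#) ^ toℕ j * (M zero j * det λ a b → M (suc a) (punchIn j b))

-- Integer polynomials as coefficient lists, constant coefficient first.  Lists
-- differing by trailing zeros denote the same polynomial, hence _≈ₚ_.
Poly : Set
Poly = List ℤ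

coeff : Poly → ℕ → ℤ
coeff []      _       = 0ℤ
coeff (a ∷ p) zero    = a
coeff (a ∷ p) (suc i) = coeff p i

infix 4 _≈ₚ_
infixl 6 _+ₚ_
infixl 7 _*ₚ_

_≈ₚ_ : Rel Poly 0ℓ
p ≈ₚ q = ∀ i → coeff p i ≡ coeff q i

_+ₚ_ : Poly → Poly → Poly
[]      +ₚ q       = q
(a ∷ p) +ₚ []      = a ∷ p
(a ∷ p) +ₚ (b ∷ q) = (a ℤ.+ b) ∷ (p +ₚ q)

-ₚ_ : Poly → Poly
-ₚ_ = map (ℤ.-_)

_*ₚ_ : Poly → Poly → Poly
[]      *ₚ q = []
(a ∷ p) *ₚ q = map (a ℤ.*_) q +ₚ (0ℤ ∷ (p *ₚ q))

constₚ : ℤ → Poly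
constₚ a = [ a ]

X : Poly
X = 0ℤ ∷ 1ℤ ∷ []

polyRawRing : RawRing 0ℓ 0ℓ
polyRawRing = record
  { Carrier = Poly
  ; _≈_     = _≈ₚ_
  ; _+_     = _+ₚ_
  ; _*_     = _*ₚ_
  ; -_      = -ₚ_
  ; 0#      = []
  ; 1#      = constₚ 1ℤ
  }

open import Algebra.Definitions.RawSemiring (RawRing.rawSemiring polyRawRing) public
  using () renaming (_^_ to _^ₚ_)

charPoly : ∀ {m} → Matrix ℤ m → Poly
charPoly A = Determinant.det polyRawRing λ i j →
  (if does (i Fin.≟ j) then X else []) +ₚ (-ₚ constₚ (A i j))

productₚ : List Poly → Poly
productₚ = foldr _*ₚ_ (constₚ 1ℤ)

-- `HasSpectrum G θs`: the multiset of eigenvalues of the adjacency matrix A of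
-- G, that is, of roots of det(X·I − A), consists of θ with multiplicity m for
-- each entry (θ , m) of θs.  The values θ are pairwise distinct and the m
-- positive, so m really is the multiplicity of θ.  Since the characteristic
-- polynomial splits completely over ℤ, there are no further real or complex
-- eigenvalues.  Multiplicities are integers so that formulas for them may use
-- untruncated subtraction; by `positive`, ℤ.∣ m ∣ is m itself.
record HasSpectrum (G : Graph) (θs : List (ℤ × ℤ)) : Set where
  field
    distinct : Unique (map proj₁ θs)
    positive : All (λ (_ , m) → 0ℤ ℤ.< m) θs
    splits   : charPoly (adjacencyMatrix G)
               ≈ₚ productₚ (map (λ (θ , m) → (X +ₚ (-ₚ constₚ θ)) ^ₚ ℤ.∣ m ∣) θs)

-- Binomial coefficient with integer lower index, zero when that is negative.
choose : ℕ → ℤ → ℤ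
choose n (+ j)    = + (n C j)
choose n -[1+ _ ] = 0ℤ

{-# OPTIONS --safe #-}

-- For the vertex-edge incidence matrix N of a graph, NᵀN is the adjacency matrix
-- of the line graph plus 2, and NNᵀ is the adjacency matrix of the graph plus its
-- degrees.  Sylvester's identity y^n det(y - MN) = y^m det(y - NM) therefore moves
-- the characteristic polynomial from the edges to the vertices of BL_n(k-1,k).
-- There y - NNᵀ is a 2 × 2 block matrix with scalar diagonal blocks, and a Schur
-- complement leaves det(z - W Wᵀ), where W is the inclusion matrix of the
-- (k-1)-subsets in the k-subsets.  Since W_j W_jᵀ = W_{j-1}ᵀ W_{j-1} + (n - 2j),
-- Sylvester's identity again descends to level 0, splitting off one linear factor
-- with multiplicity C(n,j) - C(n,j-1) at each level.  The identities are proved for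
-- the values at all large integers, where the powers of y can be cancelled.
module Submission where

open import Defs
import Algebra.Definitions.RawMonoid
import Algebra.Definitions.RawSemiring
import Algebra.Properties.Group
import Algebra.Properties.Ring
import Algebra.Properties.Semiring.Exp
import Algebra.Properties.Semiring.Sum
import Data.Bool.Properties as Bool
import Data.Fin.Properties as Fin
import Data.Integer.Properties as ℤ
import Data.Integer.Tactic.RingSolver as ℤ
import Data.List.Relation.Unary.All.Properties as All
import Data.List.Relation.Unary.AllPairs.Properties as AllPairs
import Data.List.Relation.Unary.Unique.Propositional.Properties as Unique
import Data.Nat.Properties as ℕ
import Data.Nat.Tactic.RingSolver as ℕ
import Data.Vec.Properties as Vec
import Relation.Binary.PropositionalEquality as ≡
open import Algebra.Bundles using (RawRing; CommutativeRing)
open import Data.Bool.Base using (true; false; if_then_else_; _∧_; _∨_; not)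
open import Data.Fin.Base using (Fin; zero; suc; toℕ; inject₁; lift; punchIn; splitAt; _↑ˡ_; _↑ʳ_)
open import Data.Fin.Induction using (<-weakInduction)
open import Data.Fin.Subset using (Subset; ∣_∣)
open import Data.Integer.Base as ℤ using (ℤ; 0ℤ; 1ℤ)
open import Data.List.Base using (List; []; _∷_; map; _++_; foldr; filter; length; lookup; applyUpTo; upTo)
open import Data.List.Membership.Propositional using (_∈_)
open import Data.List.Membership.Propositional.Properties using (∈-map⁻; ∈-++⁻; ∈-filter⁺; ∈-filter⁻; ∈-lookup)
open import Data.List.Properties using (length-++; filter-++)
open import Data.List.Relation.Unary.All as All using (All)
open import Data.List.Relation.Unary.AllPairs as AllPairs using (AllPairs)
open import Data.List.Relation.Unary.Any using (here; there)
open import Data.List.Relation.Unary.Unique.Propositional using (Unique)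
open import Data.Nat.Base as ℕ using (ℕ; zero; suc; _∸_; _≤_; _<_)
open import Data.Product.Base using (_×_; _,_; proj₁; proj₂)
open import Data.Sum.Base as Sum using (_⊎_; inj₁; inj₂; [_,_]′)
open import Data.Vec.Base using ([]; _∷_)
open import Function.Base using (_∘_; flip; id)
open import Level using (0ℓ)
open import Relation.Binary.Definitions using (DecidableEquality)
open ≡ using (_≡_; _≢_)
open import Relation.Nullary using (¬_; Dec; yes; no; does; contradiction; _⊎-dec_)
open import Relation.Nullary.Decidable using (dec-true; dec-false)
open import Relation.Unary using (Pred; Decidable)

-- All eigenvalues but one family have a common origin. Put k = j + 1 and y = x + 2, with x the
-- variable of the characteristic polynomial. The Schur complement evaluates the polynomial of W Wᵀ
-- at z = (y - k)(y - (n - j)). For the eigenvalue (k - i)(n - j - i) of W Wᵀ, z minus it factors as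
-- (y - i)(y - (n + 1 - i)); hence i - 2 and n - 1 - i share the multiplicity C(n,i) - C(n,i-1). For
-- i = 0 the first factor is a single y, which joins the powers of y from Sylvester's identity and
-- is the +1 in the multiplicity of -2. The remaining value k - 2 comes from a power of y - k whose
-- exponent is the difference of the two layer sizes; 2k ≤ n makes the sizes increase up to level k.
--
-- The obstacle is cancellation: each exchange leaves powers on both sides. The determinant lemmas
-- never divide and hold over any commutative ring; the cancelling is done in ℤ, at integers y > n +
-- 1, beyond every root. A polynomial vanishing at all large integers is then zero by a divisibility
-- argument on its constant coefficient.

private variable
  m n : ℕ
  A B : Set

-- Determinants

-- The transposition of `inject₁ i` and `suc i`. Its recursion matches expansion along the first
-- row: at `suc i` the first row stays and the swap passes to the minors.
swapAt : Fin n → Fin (suc n) → Fin (suc n)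
swapAt zero    zero          = suc zero
swapAt zero    (suc zero)    = zero
swapAt zero    (suc (suc j)) = suc (suc j)
swapAt (suc i) zero          = zero
swapAt (suc i) (suc j)       = suc (swapAt i j)

swapAt-inject₁ : (i : Fin n) → swapAt i (inject₁ i) ≡ suc i
swapAt-inject₁ zero    = ≡.refl
swapAt-inject₁ (suc i) = ≡.cong suc (swapAt-inject₁ i)

module SemiringIdentities (R : CommutativeRing 0ℓ 0ℓ) where
  open CommutativeRing R hiding (zero)
  open import Algebra.Solver.Ring.NaturalCoefficients.Default commutativeSemiring

  a[s[bd]]≈s[[ab]d] : ∀ a s b d → a * (s * (b * d)) ≈ s * (a * b * d)
  a[s[bd]]≈s[[ab]d] = solve 4 (λ a s b d → a :* (s :* (b :* d)) := s :* (a :* b :* d)) refl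

  distrib-middle : ∀ t a b d → t * ((a + b) * d) ≈ t * (a * d) + t * (b * d)
  distrib-middle = solve 4 (λ t a b d → t :* ((a :+ b) :* d) := t :* (a :* d) :+ t :* (b :* d)) refl

  scale-middle : ∀ t a b d → t * (a * b * d) ≈ a * (t * (b * d))
  scale-middle = solve 4 (λ t a b d → t :* (a :* b :* d) := a :* (t :* (b :* d))) refl

  -- The solver knows no negation, so `ν` stands for -1; its square is replaced by 1 where the
  -- identity is applied.
  minors : ∀ ν s b c → (ν * s) * (1# * b + ν * c) ≈ ν * (s * b) + (ν * ν) * (s * c)
  minors = solve 4 (λ ν s b c → (ν :* s) :* (con 1 :* b :+ ν :* c) := ν :* (s :* b) :+ (ν :* ν) :* (s :* c)) refl

module Sums (R : CommutativeRing 0ℓ 0ℓ) where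
  open CommutativeRing R hiding (zero)
  open Algebra.Properties.Ring ring using (-‿+-comm; -0#≈0#)
  open Algebra.Properties.Semiring.Sum semiring
    using (sum; sum-cong-≋; sum-replicate-zero; ∑-distrib-+; *-distribˡ-sum; *-distribʳ-sum)

  -- Opaque, so that summands can be inferred by unification.
  opaque
    ∑ : (Fin n → Carrier) → Carrier
    ∑ = sum

    ∑≡sum : (f : Fin n → Carrier) → ∑ f ≡ sum f
    ∑≡sum f = ≡.refl

    ∑-zero : (f : Fin 0 → Carrier) → ∑ f ≈ 0#
    ∑-zero f = refl

    ∑-suc : (f : Fin (suc n) → Carrier) → ∑ f ≈ f zero + ∑ (f ∘ suc)
    ∑-suc f = refl

    ∑-cong : {f g : Fin n → Carrier} → (∀ i → f i ≈ g i) → ∑ f ≈ ∑ g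
    ∑-cong {f = f} {g} = sum-cong-≋ {x = f} {g}

    ∑-+ : (f g : Fin n → Carrier) → ∑ (λ i → f i + g i) ≈ ∑ f + ∑ g
    ∑-+ = ∑-distrib-+

    *-distribˡ-∑ : ∀ x (f : Fin n → Carrier) → x * ∑ f ≈ ∑ λ i → x * f i
    *-distribˡ-∑ = *-distribˡ-sum

    *-distribʳ-∑ : ∀ x (f : Fin n → Carrier) → ∑ f * x ≈ ∑ λ i → f i * x
    *-distribʳ-∑ = *-distribʳ-sum

    ∑-0 : {f : Fin n → Carrier} → (∀ i → f i ≈ 0#) → ∑ f ≈ 0#
    ∑-0 {n} f≗0 = trans (sum-cong-≋ f≗0) (sum-replicate-zero n)

  ∑-neg : (f : Fin n → Carrier) → ∑ (λ i → - f i) ≈ - ∑ f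
  ∑-neg {zero}  f = trans (∑-zero _) (trans (sym -0#≈0#) (-‿cong (sym (∑-zero f))))
  ∑-neg {suc n} f = trans (∑-suc _) (trans (+-congˡ (∑-neg (f ∘ suc)))
    (trans (-‿+-comm _ _) (-‿cong (sym (∑-suc f)))))

module Determinants (R : CommutativeRing 0ℓ 0ℓ) where
  open CommutativeRing R hiding (zero)
  open Algebra.Properties.Group +-group using (inverseʳ-unique; ⁻¹-involutive)
  open Algebra.Properties.Ring ring
    using (-1*x≈-x; -‿distribˡ-*; -‿distribʳ-*; -0#≈0#)
  open Algebra.Definitions.RawSemiring (RawRing.rawSemiring rawRing) using (_^_)
  open import Relation.Binary.Reasoning.Setoid setoid
  open SemiringIdentities R
  open Sums R

  sign : Fin n → Carrier
  sign j = (- 1#) ^ toℕ j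

  private
    det-cong-sum : {M N : Matrix Carrier n} → (∀ i j → M i j ≈ N i j) →
      Determinant.det rawRing M ≈ Determinant.det rawRing N
    det-cong-sum {zero}  M≈N = refl
    det-cong-sum {suc n} {M} {N} M≈N =
      trans (reflexive (≡.sym (∑≡sum (term M)))) (trans (∑-cong λ j → *-congˡ
        (*-cong (M≈N zero j) (det-cong-sum λ a b → M≈N (suc a) (punchIn j b)))) (reflexive (∑≡sum (term N))))
      where
      term : Matrix Carrier (suc n) → Fin (suc n) → Carrier
      term M j = sign j * (M zero j * Determinant.det rawRing λ a b → M (suc a) (punchIn j b))

  opaque
    det : Matrix Carrier n → Carrier
    det = Determinant.det rawRing

    det≡ : (M : Matrix Carrier n) → det M ≡ Determinant.det rawRing M
    det≡ M = ≡.refl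

    det-cong : {M N : Matrix Carrier n} → (∀ i j → M i j ≈ N i j) → det M ≈ det N
    det-cong = det-cong-sum

  -- Keeping the first row apart from the others lets linearity in that row be stated without
  -- rebuilding a matrix.
  detRow : (Fin (suc n) → Carrier) → (Fin n → Fin (suc n) → Carrier) → Carrier
  detRow r M = ∑ λ j → sign j * (r j * det λ a b → M a (punchIn j b))

  opaque
    unfolding det

    det-zero : (M : Matrix Carrier 0) → det M ≈ 1#
    det-zero M = refl

    det-suc : (M : Matrix Carrier (suc n)) → det M ≈ detRow (M zero) (M ∘ suc)
    det-suc M = reflexive (≡.sym (∑≡sum λ j →
      sign j * (M zero j * Determinant.det rawRing λ a b → M (suc a) (punchIn j b))))

  detRow-congʳ : (r : Fin (suc n) → Carrier) (M N : Fin n → Fin (suc n) → Carrier) →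
    (∀ j → det (λ a b → M a (punchIn j b)) ≈ det (λ a b → N a (punchIn j b))) → detRow r M ≈ detRow r N
  detRow-congʳ r M N M≈N = ∑-cong λ j → *-congˡ (*-congˡ (M≈N j))

  detRow-congˡ : {r s : Fin (suc n) → Carrier} (M : Fin n → Fin (suc n) → Carrier) →
    (∀ j → r j ≈ s j) → detRow r M ≈ detRow s M
  detRow-congˡ M r≈s = ∑-cong λ j → *-congˡ (*-congʳ (r≈s j))

  detRow-+ : (r s : Fin (suc n) → Carrier) (M : Fin n → Fin (suc n) → Carrier) →
    detRow (λ j → r j + s j) M ≈ detRow r M + detRow s M
  detRow-+ r s M = trans (∑-cong λ j → distrib-middle (sign j) (r j) (s j) _) (∑-+ _ _)

  detRow-* : ∀ a (r : Fin (suc n) → Carrier) (M : Fin n → Fin (suc n) → Carrier) →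
    detRow (λ j → a * r j) M ≈ a * detRow r M
  detRow-* a r M = trans (∑-cong λ j → scale-middle (sign j) a (r j) _) (sym (*-distribˡ-∑ a _))

  detRow-0 : {r : Fin (suc n) → Carrier} (M : Fin n → Fin (suc n) → Carrier) →
    (∀ j → r j ≈ 0#) → detRow r M ≈ 0#
  detRow-0 M r≈0 = ∑-0 λ j → trans (*-congˡ (trans (*-congʳ (r≈0 j)) (zeroˡ _))) (zeroʳ (sign j))

  detRow-∑ : (β : Fin m → Carrier) (r : Fin m → Fin (suc n) → Carrier) (M : Fin n → Fin (suc n) → Carrier) →
    detRow (λ j → ∑ λ l → β l * r l j) M ≈ ∑ λ l → β l * detRow (r l) M
  detRow-∑ {zero}  β r M = trans (detRow-0 M λ j → ∑-zero _) (sym (∑-zero _))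
  detRow-∑ {suc m} β r M = begin
    detRow (λ j → ∑ λ l → β l * r l j) M
      ≈⟨ detRow-congˡ M (λ j → ∑-suc _) ⟩
    detRow (λ j → β zero * r zero j + ∑ λ l → β (suc l) * r (suc l) j) M
      ≈⟨ detRow-+ (λ j → β zero * r zero j) (λ j → ∑ λ l → β (suc l) * r (suc l) j) M ⟩
    detRow (λ j → β zero * r zero j) M + detRow (λ j → ∑ λ l → β (suc l) * r (suc l) j) M
      ≈⟨ +-cong (detRow-* (β zero) (r zero) M) (detRow-∑ (β ∘ suc) (r ∘ suc) M) ⟩
    β zero * detRow (r zero) M + ∑ (λ l → β (suc l) * detRow (r (suc l)) M)
      ≈⟨ ∑-suc _ ⟨
    ∑ (λ l → β l * detRow (r l) M) ∎

  -- Expansion along two rows: w i j is the product of the entries taken from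
  -- columns i and j, and h f the minor on the columns f.
  laplace₂ : (Fin (suc (suc n)) → Fin (suc (suc n)) → Carrier) →
             ((Fin n → Fin (suc (suc n))) → Carrier) → Carrier
  laplace₂ w h =
    ∑ λ j → sign j * ∑ λ k → sign k * (w j (punchIn j k) * h λ x → punchIn j (punchIn k x))

  -- Minors are indexed by column maps, and maps that agree pointwise need not be equal as
  -- functions.
  Extensional : ((Fin m → Fin n) → Carrier) → Set
  Extensional h = ∀ {f g} → (∀ x → f x ≡ g x) → h f ≈ h g

  -- The two orders of choosing a pair of columns carry opposite signs and, by symmetry of `w`,
  -- equal products. Pairs containing column 0 cancel as `edge` and its negative; the others form
  -- the same expression one size smaller. Cancelling in pairs is valid in any ring, whereas
  -- antisymmetry alone would only show that twice the sum is 0.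
  laplace₂-symmetric : ∀ w (h : (Fin n → Fin (suc (suc n))) → Carrier) → Extensional h →
    (∀ i j → w i j ≈ w j i) → laplace₂ w h ≈ 0#
  laplace₂-symmetric {n} w h ext w-sym = begin
    laplace₂ w h
      ≈⟨ trans (∑-suc _) (+-cong (*-identityˡ edge) (∑-cong λ j → *-congˡ (∑-suc _))) ⟩
    edge + ∑ (λ j → (- 1# * sign j) * (1# * (w (suc j) zero * h₀ j) + ∑ λ k → (- 1# * sign k) * inner j k))
      ≈⟨ +-congˡ (∑-cong λ j → *-congˡ (+-cong (*-congˡ (*-congʳ (w-sym (suc j) zero)))
           (trans (∑-cong λ k → *-assoc (- 1#) (sign k) (inner j k)) (sym (*-distribˡ-∑ (- 1#) _))))) ⟩
    edge + ∑ (λ j → (- 1# * sign j) * (1# * (w zero (suc j) * h₀ j) + - 1# * ∑ λ k → sign k * inner j k))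
      ≈⟨ +-congˡ (∑-cong λ j → trans (minors (- 1#) (sign j) (w zero (suc j) * h₀ j) (∑ λ k → sign k * inner j k))
           (+-congˡ (trans (*-congʳ (trans (-1*x≈-x (- 1#)) (⁻¹-involutive 1#))) (*-identityˡ _)))) ⟩
    edge + ∑ (λ j → - 1# * (sign j * (w zero (suc j) * h₀ j)) + sign j * ∑ λ k → sign k * inner j k)
      ≈⟨ +-congˡ (trans (∑-+ _ _) (+-cong (trans (sym (*-distribˡ-∑ (- 1#) _)) (-1*x≈-x edge)) (rest n w h ext w-sym))) ⟩
    edge + (- edge + 0#)
      ≈⟨ trans (+-congˡ (+-identityʳ (- edge))) (-‿inverseʳ edge) ⟩
    0# ∎
    where
    h₀ : Fin (suc n) → Carrier
    h₀ j = h λ x → suc (punchIn j x)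
    edge = ∑ λ k → sign k * (w zero (suc k) * h₀ k)
    inner : Fin (suc n) → Fin n → Carrier
    inner j k = w (suc j) (suc (punchIn j k)) * h λ x → punchIn (suc j) (punchIn (suc k) x)
    rest : ∀ n (w : Fin (suc (suc n)) → Fin (suc (suc n)) → Carrier) (h : (Fin n → Fin (suc (suc n))) → Carrier) → Extensional h → (∀ i j → w i j ≈ w j i) →
      (∑ λ j → sign j * ∑ λ k → sign k *
        (w (suc j) (suc (punchIn j k)) * h λ x → punchIn (suc j) (punchIn (suc k) x))) ≈ 0#
    rest zero    w h ext w-sym = ∑-0 λ j → trans (*-congˡ (∑-zero _)) (zeroʳ (sign j))
    rest (suc n) w h ext w-sym = trans
      (∑-cong λ j → *-congˡ (∑-cong λ k → *-congˡ (*-congˡ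
        (ext {g = lift 1 λ x → punchIn j (punchIn k x)} λ { zero → ≡.refl ; (suc x) → ≡.refl }))))
      (laplace₂-symmetric (λ i j → w (suc i) (suc j)) (h ∘ lift 1)
        (λ {f} {g} f≗g → ext {lift 1 f} {lift 1 g} λ { zero → ≡.refl ; (suc x) → ≡.cong suc (f≗g x) })
        λ i j → w-sym (suc i) (suc j))

  laplace₂-cong : ∀ {v w} (h : (Fin n → Fin (suc (suc n))) → Carrier) →
    (∀ i j → v i j ≈ w i j) → laplace₂ v h ≈ laplace₂ w h
  laplace₂-cong h v≈w = ∑-cong λ j → *-congˡ (∑-cong λ k → *-congˡ (*-congʳ (v≈w j (punchIn j k))))

  laplace₂-+ : ∀ v w (h : (Fin n → Fin (suc (suc n))) → Carrier) →
    laplace₂ (λ i j → v i j + w i j) h ≈ laplace₂ v h + laplace₂ w h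
  laplace₂-+ v w h = trans
    (∑-cong λ j → trans
      (*-congˡ (trans (∑-cong λ k → distrib-middle (sign k) _ _ _) (∑-+ _ _)))
      (distribˡ (sign j) _ _))
    (∑-+ _ _)

  det-laplace₂ : (M : Matrix Carrier (suc (suc n))) →
    det M ≈ laplace₂ (λ i j → M zero i * M (suc zero) j) (λ f → det λ a b → M (suc (suc a)) (f b))
  det-laplace₂ M = trans (det-suc M) (∑-cong λ j → *-congˡ (trans (*-congˡ (det-suc _))
    (trans (*-distribˡ-∑ (M zero j) _)
           (∑-cong λ k → a[s[bd]]≈s[[ab]d] (M zero j) (sign k) (M (suc zero) (punchIn j k)) _))))

  -- For the first two rows, the two determinants add up to an expansion with symmetric weights,
  -- which is 0. A lower swap takes place inside the minors.
  det-swap : (i : Fin n) (M : Matrix Carrier (suc n)) → det (M ∘ swapAt i) ≈ - det M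
  det-swap {suc n} zero M = begin
    det (M ∘ swapAt zero)
      ≈⟨ det-laplace₂ (M ∘ swapAt zero) ⟩
    laplace₂ (λ i j → M (suc zero) i * M zero j) h
      ≈⟨ laplace₂-cong {v = λ i j → M (suc zero) i * M zero j} {flip w} h (λ i j → *-comm (M (suc zero) i) (M zero j)) ⟩
    laplace₂ (flip w) h
      ≈⟨ inverseʳ-unique (laplace₂ w h) (laplace₂ (flip w) h) (trans (sym (laplace₂-+ w (flip w) h))
           (laplace₂-symmetric (λ i j → w i j + w j i) h (λ f≗g → det-cong λ a b → reflexive (≡.cong (M (suc (suc a))) (f≗g b)))
             λ i j → +-comm (w i j) (w j i))) ⟩
    - laplace₂ w h
      ≈⟨ -‿cong (det-laplace₂ M) ⟨
    - det M ∎
    where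
    w : Fin (suc (suc n)) → Fin (suc (suc n)) → Carrier
    w i j = M zero i * M (suc zero) j
    h : (Fin n → Fin (suc (suc n))) → Carrier
    h f = det λ a b → M (suc (suc a)) (f b)
  det-swap {suc n} (suc i) M = begin
    det (M ∘ swapAt (suc i))
      ≈⟨ det-suc (M ∘ swapAt (suc i)) ⟩
    detRow (M zero) (M ∘ swapAt (suc i) ∘ suc)
      ≈⟨ ∑-cong (λ j → trans
           (*-congˡ (trans (*-congˡ (det-swap i λ a b → M (suc a) (punchIn j b))) (sym (-‿distribʳ-* _ _))))
           (sym (-‿distribʳ-* _ _))) ⟩
    ∑ (λ j → - (sign j * (M zero j * det λ a b → M (suc a) (punchIn j b))))
      ≈⟨ ∑-neg _ ⟩
    - detRow (M zero) (M ∘ suc)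
      ≈⟨ -‿cong (det-suc M) ⟨
    - det M ∎

  -- Adjacent swaps carry the copy of the first row upwards until it is the second row, where
  -- `laplace₂-symmetric` applies.
  det-row≈ : (i : Fin n) (M : Matrix Carrier (suc n)) → (∀ j → M zero j ≈ M (suc i) j) → det M ≈ 0#
  det-row≈ {suc n} = <-weakInduction
    (λ i → (M : Matrix Carrier (suc (suc n))) → (∀ j → M zero j ≈ M (suc i) j) → det M ≈ 0#) base step
    where
    base : (M : Matrix Carrier (suc (suc n))) → (∀ j → M zero j ≈ M (suc zero) j) → det M ≈ 0#
    base M eq = trans (det-laplace₂ M) (laplace₂-symmetric (λ i j → M zero i * M (suc zero) j)
      (λ f → det λ a b → M (suc (suc a)) (f b))
      (λ f≗g → det-cong λ a b → reflexive (≡.cong (M (suc (suc a))) (f≗g b)))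
      λ i j → trans (*-cong (eq i) (sym (eq j))) (*-comm _ _))
    step : ∀ i → ((M : Matrix Carrier (suc (suc n))) → (∀ j → M zero j ≈ M (suc (inject₁ i)) j) → det M ≈ 0#) →
      (M : Matrix Carrier (suc (suc n))) → (∀ j → M zero j ≈ M (suc (suc i)) j) → det M ≈ 0#
    step i IH M eq = begin
      det M                            ≈⟨ ⁻¹-involutive (det M) ⟨
      - - det M                        ≈⟨ -‿cong (det-swap (suc i) M) ⟨
      - det (M ∘ swapAt (suc i))       ≈⟨ -‿cong (IH (M ∘ swapAt (suc i)) λ j →
                                            trans (eq j) (reflexive (≡.cong (λ r → M (suc r) j) (≡.sym (swapAt-inject₁ i))))) ⟩
      - 0#                             ≈⟨ -0#≈0# ⟩
      0#                               ∎

  detRow-row≈ : (i : Fin n) (r : Fin (suc n) → Carrier) (M : Fin n → Fin (suc n) → Carrier) →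
    (∀ j → r j ≈ M i j) → detRow r M ≈ 0#
  detRow-row≈ i r M eq = trans (sym (det-suc N)) (det-row≈ i N eq)
    where
    N : Matrix Carrier (suc _)
    N zero    = r
    N (suc i) = M i

  -- Moving row r to second place makes the row to be cleared the first one, in
  -- which the determinant is linear; expanding along it leaves the same problem
  -- for its minors.
  det-clear : (r : Fin (suc n) → Carrier) (u : Fin n → Carrier) (M : Fin n → Fin (suc n) → Carrier) →
    detRow r (λ i j → M i j + u i * r j) ≈ detRow r M
  det-clear {zero}  r u M = detRow-congʳ r (λ i j → M i j + u i * r j) M λ j → trans (det-zero _) (sym (det-zero _))
  det-clear {suc n} r u M = begin
    detRow r (K ∘ suc)              ≈⟨ det-suc K ⟨
    det K                           ≈⟨ ⁻¹-involutive (det K) ⟨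
    - - det K                       ≈⟨ -‿cong (det-swap zero K) ⟨
    - det (K ∘ swapAt zero)         ≈⟨ -‿cong (det-suc (K ∘ swapAt zero)) ⟩
    - detRow (λ j → M zero j + u zero * r j) K′
      ≈⟨ -‿cong (detRow-+ (M zero) (λ j → u zero * r j) K′) ⟩
    - (detRow (M zero) K′ + detRow (λ j → u zero * r j) K′)
      ≈⟨ -‿cong (+-congˡ (trans (detRow-* (u zero) r K′)
           (trans (*-congˡ (detRow-row≈ zero r K′ λ j → refl)) (zeroʳ (u zero))))) ⟩
    - (detRow (M zero) K′ + 0#)     ≈⟨ -‿cong (+-identityʳ _) ⟩
    - detRow (M zero) K′
      ≈⟨ -‿cong (detRow-congʳ (M zero) K′ (L ∘ swapAt zero ∘ suc) λ j → trans (trans (det-suc _)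
           (det-clear (r ∘ punchIn j) (u ∘ suc) (λ a b → M (suc a) (punchIn j b)))) (sym (det-suc _))) ⟩
    - detRow (M zero) (L ∘ swapAt zero ∘ suc)
                                    ≈⟨ -‿cong (det-suc (L ∘ swapAt zero)) ⟨
    - det (L ∘ swapAt zero)         ≈⟨ -‿cong (det-swap zero L) ⟩
    - - det L                       ≈⟨ ⁻¹-involutive (det L) ⟩
    det L                           ≈⟨ det-suc L ⟩
    detRow r M                      ∎
    where
    K L : Matrix Carrier (suc (suc n))
    K zero    j = r j
    K (suc i) j = M i j + u i * r j
    L zero    j = r j
    L (suc i) j = M i j
    K′ : Fin (suc n) → Fin (suc (suc n)) → Carrier
    K′ = K ∘ swapAt zero ∘ suc

  -- In the expansion along the first row, the first term vanishes through its entry; every other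
  -- minor still contains the zero column as its own first column.
  det-column-0 : (M : Matrix Carrier (suc n)) → (∀ i → M i zero ≈ 0#) → det M ≈ 0#
  minor-column-0 : (j : Fin n) (M : Fin n → Fin (suc n) → Carrier) → (∀ i → M i zero ≈ 0#) →
    det (λ a b → M a (punchIn (suc j) b)) ≈ 0#

  det-column-0 M eq = trans (det-suc M) (∑-0 λ where
    zero    → trans (*-congˡ (trans (*-congʳ (eq zero)) (zeroˡ _))) (zeroʳ _)
    (suc j) → trans (*-congˡ (trans (*-congˡ (minor-column-0 j (M ∘ suc) (eq ∘ suc))) (zeroʳ _))) (zeroʳ _))

  minor-column-0 {suc n} j M eq = det-column-0 (λ a b → M a (punchIn (suc j) b)) eq

  -- Gaussian elimination with a pivot that needs no division: multiples of the first row clear the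
  -- first column, and only the minor at the pivot survives.
  det-pivot : (M : Matrix Carrier (suc n)) → M zero zero ≈ 1# →
    det M ≈ det λ i j → M (suc i) (suc j) - M (suc i) zero * M zero (suc j)
  det-pivot {n} M eq = begin
    det M
      ≈⟨ det-suc M ⟩
    detRow r S
      ≈⟨ det-clear r (λ i → - S i zero) S ⟨
    detRow r K
      ≈⟨ ∑-suc _ ⟩
    1# * (r zero * det (λ i j → K i (suc j))) + ∑ (λ j → sign (suc j) * (r (suc j) * det λ a b → K a (punchIn (suc j) b)))
      ≈⟨ +-cong (trans (*-identityˡ _) (trans (*-congʳ eq) (*-identityˡ _)))
           (∑-0 λ j → trans (*-congˡ (trans (*-congˡ (minor-column-0 j K K₀)) (zeroʳ _))) (zeroʳ _)) ⟩
    det (λ i j → K i (suc j)) + 0#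
      ≈⟨ +-identityʳ _ ⟩
    det (λ i j → K i (suc j))
      ≈⟨ det-cong (λ i j → +-congˡ (-‿distribˡ-* (S i zero) (r (suc j)))) ⟨
    det (λ i j → S i (suc j) - S i zero * r (suc j)) ∎
    where
    r = M zero
    S = M ∘ suc
    K : Fin n → Fin (suc n) → Carrier
    K i j = S i j + - S i zero * r j
    K₀ : ∀ i → K i zero ≈ 0#
    K₀ i = trans (+-congˡ (trans (*-congˡ eq) (*-identityʳ _))) (-‿inverseʳ _)

-- Block matrices, Schur complements and Sylvester's identity

stack : (Fin m → A) → (Fin n → A) → Fin (m ℕ.+ n) → A
stack {m = m} T S i = [ T , S ]′ (splitAt m i)

block : (Fin m → Fin m → A) → (Fin m → Fin n → A) → (Fin n → Fin m → A) → (Fin n → Fin n → A) →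
        Matrix A (m ℕ.+ n)
block A B C D = stack (λ i → stack (A i) (B i)) (λ i → stack (C i) (D i))

-- Deleting a column of the left part leaves the right part of a block matrix untouched.
splitAt-punchIn-↑ˡ : (j : Fin (suc m)) (c : Fin (m ℕ.+ n)) →
  splitAt (suc m) (punchIn (j ↑ˡ n) c) ≡ Sum.map (punchIn j) id (splitAt m c)
splitAt-punchIn-↑ˡ         zero    c       = ≡.refl
splitAt-punchIn-↑ˡ {suc m} (suc j) zero    = ≡.refl
splitAt-punchIn-↑ˡ {suc m} (suc j) (suc c)
  rewrite splitAt-punchIn-↑ˡ j c with splitAt m c
... | inj₁ _ = ≡.refl
... | inj₂ _ = ≡.refl

module BlockDeterminants (R : CommutativeRing 0ℓ 0ℓ) where
  open CommutativeRing R hiding (zero)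
  open Algebra.Properties.Ring ring using (-‿distribˡ-*; -‿+-comm; -0#≈0#)
  open Algebra.Properties.Semiring.Exp semiring using (_^_)
  open import Algebra.Solver.Ring.NaturalCoefficients.Default commutativeSemiring
    using (solve; _:*_; _:=_)
  open import Relation.Binary.Reasoning.Setoid setoid
  open Sums R
  open Determinants R

  𝟏 : Matrix Carrier n
  𝟏 i j = if does (i Fin.≟ j) then 1# else 0#

  𝟏-block : ∀ m (i j : Fin (m ℕ.+ n)) → 𝟏 i j ≡ block {m = m} 𝟏 (λ _ _ → 0#) (λ _ _ → 0#) 𝟏 i j
  𝟏-block zero    i       j       = ≡.refl
  𝟏-block (suc m) zero    zero    = ≡.refl
  𝟏-block (suc m) zero    (suc j) with splitAt m j
  ... | inj₁ _ = ≡.refl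
  ... | inj₂ _ = ≡.refl
  𝟏-block (suc m) (suc i) zero    with splitAt m i
  ... | inj₁ _ = ≡.refl
  ... | inj₂ _ = ≡.refl
  𝟏-block (suc m) (suc i) (suc j) = ≡.trans (𝟏-block m i j) (shift i j)
    where
    shift : ∀ i j → block {m = m} 𝟏 (λ _ _ → 0#) (λ _ _ → 0#) 𝟏 i j
      ≡ block {m = suc m} 𝟏 (λ _ _ → 0#) (λ _ _ → 0#) 𝟏 (suc i) (suc j)
    shift i j with splitAt m i
    shift i j | inj₁ _ with splitAt m j
    ... | inj₁ _ = ≡.refl
    ... | inj₂ _ = ≡.refl
    shift i j | inj₂ _ with splitAt m j
    ... | inj₁ _ = ≡.refl
    ... | inj₂ _ = ≡.refl

  ∑-select : (f : Fin n → Carrier) (j : Fin n) → ∑ (λ l → f l * 𝟏 l j) ≈ f j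
  ∑-select {suc n} f zero = trans (∑-suc _) (trans
    (+-cong (*-identityʳ (f zero)) (∑-0 λ l → zeroʳ (f (suc l)))) (+-identityʳ (f zero)))
  ∑-select {suc n} f (suc j) = trans (∑-suc _) (trans
    (+-cong (zeroʳ (f zero)) (∑-select (f ∘ suc) j)) (+-identityˡ (f (suc j))))

  ∑-splitAt : (f : Fin (m ℕ.+ n) → Carrier) → ∑ f ≈ ∑ (λ i → f (i ↑ˡ n)) + ∑ (λ j → f (m ↑ʳ j))
  ∑-splitAt {zero}  f = sym (trans (+-congʳ (∑-zero _)) (+-identityˡ _))
  ∑-splitAt {suc m} f = trans (∑-suc f) (trans (+-congˡ (∑-splitAt {m} (f ∘ suc)))
    (trans (sym (+-assoc _ _ _)) (+-congʳ (sym (∑-suc _)))))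

  -- Pivoting on the diagonal of the unit block one entry at a time; each pivot subtracts one
  -- rank-one summand of the product M N from `A`.
  det-unitBlock : (N : Fin n → Fin m → Carrier) (M : Fin m → Fin n → Carrier) (A : Matrix Carrier m) →
    det (block 𝟏 N M A) ≈ det λ i j → A i j - ∑ λ l → M i l * N l j
  det-unitBlock {zero}  N M A = det-cong λ i j →
    sym (trans (+-congˡ (trans (-‿cong (∑-zero _)) -0#≈0#)) (+-identityʳ _))
  det-unitBlock {suc n} {m} N M A = begin
    det (block 𝟏 N M A)
      ≈⟨ det-pivot (block 𝟏 N M A) refl ⟩
    det (λ i j → block 𝟏 N M A (suc i) (suc j) - block 𝟏 N M A (suc i) zero * block 𝟏 N M A zero (suc j))
      ≈⟨ det-cong pivoted ⟩
    det (block 𝟏 (N ∘ suc) (λ i → M i ∘ suc) A′)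
      ≈⟨ det-unitBlock (N ∘ suc) (λ i → M i ∘ suc) A′ ⟩
    det (λ i j → A′ i j - ∑ λ l → M i (suc l) * N (suc l) j)
      ≈⟨ det-cong (λ i j → trans (+-assoc _ _ _) (+-congˡ (trans (-‿+-comm _ _) (-‿cong (sym (∑-suc _)))))) ⟩
    det (λ i j → A i j - ∑ λ l → M i l * N l j) ∎
    where
    A′ : Matrix Carrier m
    A′ i j = A i j - M i zero * N zero j
    x-0≈x : ∀ {x y} → y ≈ 0# → x - y ≈ x
    x-0≈x y≈0 = trans (+-congˡ (trans (-‿cong y≈0) -0#≈0#)) (+-identityʳ _)
    pivoted : ∀ i j →
      block 𝟏 N M A (suc i) (suc j) - block 𝟏 N M A (suc i) zero * block 𝟏 N M A zero (suc j)
      ≈ block 𝟏 (N ∘ suc) (λ i → M i ∘ suc) A′ i j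
    pivoted i j with splitAt n i
    pivoted i j | inj₁ a with splitAt n j
    ... | inj₁ b = x-0≈x (zeroˡ _)
    ... | inj₂ b = x-0≈x (zeroˡ _)
    pivoted i j | inj₂ a with splitAt n j
    ... | inj₁ b = x-0≈x (zeroʳ _)
    ... | inj₂ b = refl

  detRow-scale : ∀ c (r : Fin (suc n) → Carrier) (M N : Fin n → Fin (suc n) → Carrier) →
    (∀ j → det (λ a b → M a (punchIn j b)) ≈ c * det (λ a b → N a (punchIn j b))) →
    detRow r M ≈ c * detRow r N
  detRow-scale c r M N M≈cN = trans
    (∑-cong λ j → trans (*-congˡ (*-congˡ (M≈cN j)))
      (solve 4 (λ s r c d → s :* (r :* (c :* d)) := c :* (s :* (r :* d))) refl (sign j) (r j) c _))
    (sym (*-distribˡ-∑ c _))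

  -- Each top row contributes a factor `δ` by linearity; the added combination of bottom rows
  -- contributes determinants with a repeated row, which vanish.
  det-rows : ∀ δ (β : Fin m → Fin n → Carrier) (T : Fin m → Fin (m ℕ.+ n) → Carrier) (S : Fin n → Fin (m ℕ.+ n) → Carrier) →
    det (stack (λ i j → δ * T i j + ∑ λ l → β i l * S l j) S) ≈ δ ^ m * det (stack T S)
  det-rows {zero}      δ β T S = sym (*-identityˡ _)
  det-rows {suc m} {n} δ β T S = begin
    det (stack T′ S)
      ≈⟨ det-suc (stack T′ S) ⟩
    detRow (T′ zero) K
      ≈⟨ detRow-+ (λ j → δ * T zero j) (λ j → ∑ λ l → β zero l * S l j) K ⟩
    detRow (λ j → δ * T zero j) K + detRow (λ j → ∑ λ l → β zero l * S l j) K
      ≈⟨ +-cong (detRow-* δ (T zero) K) (trans (detRow-∑ (β zero) S K)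
           (∑-0 λ l → trans (*-congˡ (detRow-row≈ (m ↑ʳ l) (S l) K λ j → reflexive (bottom l j))) (zeroʳ _))) ⟩
    δ * detRow (T zero) K + 0#
      ≈⟨ +-identityʳ _ ⟩
    δ * detRow (T zero) K
      ≈⟨ *-congˡ (detRow-scale (δ ^ m) (T zero) K L λ j → trans (det-cong λ a b → K-minor j a b)
           (trans (det-rows δ (β ∘ suc) (λ i → T (suc i) ∘ punchIn j) (λ l → S l ∘ punchIn j))
             (*-congˡ (det-cong λ a b → L-minor j a b)))) ⟩
    δ * (δ ^ m * detRow (T zero) L)
      ≈⟨ *-assoc δ _ _ ⟨
    δ ^ suc m * detRow (T zero) L
      ≈⟨ *-congˡ (det-suc (stack T S)) ⟨
    δ ^ suc m * det (stack T S) ∎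
    where
    T′ : Fin (suc m) → Fin (suc m ℕ.+ n) → Carrier
    T′ i j = δ * T i j + ∑ λ l → β i l * S l j
    K L : Fin (m ℕ.+ n) → Fin (suc m ℕ.+ n) → Carrier
    K = stack T′ S ∘ suc
    L = stack T S ∘ suc
    bottom : ∀ l j → S l j ≡ K (m ↑ʳ l) j
    bottom l j rewrite Fin.splitAt-↑ʳ m n l = ≡.refl
    K-minor : ∀ j a b → K a (punchIn j b) ≈
      stack (λ i b → δ * T (suc i) (punchIn j b) + ∑ λ l → β (suc i) l * S l (punchIn j b)) (λ l → S l ∘ punchIn j) a b
    K-minor j a b with splitAt m a
    ... | inj₁ _ = refl
    ... | inj₂ _ = refl
    L-minor : ∀ j a b → stack (λ i → T (suc i) ∘ punchIn j) (λ l → S l ∘ punchIn j) a b ≈ L a (punchIn j b)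
    L-minor j a b with splitAt m a
    ... | inj₁ _ = refl
    ... | inj₂ _ = refl

  -- The first row is zero on the right part, so only minors that delete a left column remain, and
  -- these have the same shape.
  det-lowerBlock : (A : Matrix Carrier m) (C : Fin n → Fin m → Carrier) (D : Matrix Carrier n) →
    det (block A (λ _ _ → 0#) C D) ≈ det A * det D
  det-lowerBlock {zero}      A C D = sym (trans (*-congʳ (det-zero A)) (*-identityˡ _))
  det-lowerBlock {suc m} {n} A C D = begin
    det K
      ≈⟨ trans (det-suc K) (∑-splitAt {suc m} _) ⟩
    ∑ (λ j → sign (j ↑ˡ n) * (K zero (j ↑ˡ n) * det (λ a b → K (suc a) (punchIn (j ↑ˡ n) b))))
    + ∑ (λ j → sign (suc m ↑ʳ j) * (K zero (suc m ↑ʳ j) * det (λ a b → K (suc a) (punchIn (suc m ↑ʳ j) b))))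
      ≈⟨ +-cong (∑-cong left) (∑-0 right) ⟩
    ∑ (λ j → (sign j * (A zero j * det (λ a b → A (suc a) (punchIn j b)))) * det D) + 0#
      ≈⟨ trans (+-identityʳ _) (sym (*-distribʳ-∑ (det D) _)) ⟩
    detRow (A zero) (A ∘ suc) * det D
      ≈⟨ *-congʳ (det-suc A) ⟨
    det A * det D ∎
    where
    K = block A (λ _ _ → 0#) C D
    minor : ∀ j a b → K (suc a) (punchIn (j ↑ˡ n) b) ≈
      block (λ a b → A (suc a) (punchIn j b)) (λ _ _ → 0#) (λ i → C i ∘ punchIn j) D a b
    minor j a b with splitAt m a
    minor j a b | inj₁ _ rewrite splitAt-punchIn-↑ˡ {m} {n} j b with splitAt m b
    ... | inj₁ _ = refl
    ... | inj₂ _ = refl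
    minor j a b | inj₂ _ rewrite splitAt-punchIn-↑ˡ {m} {n} j b with splitAt m b
    ... | inj₁ _ = refl
    ... | inj₂ _ = refl
    entry : ∀ j → K zero (j ↑ˡ n) ≡ A zero j
    entry j rewrite Fin.splitAt-↑ˡ (suc m) j n = ≡.refl
    left : ∀ j → sign (j ↑ˡ n) * (K zero (j ↑ˡ n) * det (λ a b → K (suc a) (punchIn (j ↑ˡ n) b)))
      ≈ (sign j * (A zero j * det (λ a b → A (suc a) (punchIn j b)))) * det D
    left j = trans
      (*-cong (reflexive (≡.cong ((- 1#) ^_) (Fin.toℕ-↑ˡ j n))) (*-cong (reflexive (entry j))
        (trans (det-cong (minor j)) (det-lowerBlock _ (λ i → C i ∘ punchIn j) D))))
      (solve 4 (λ s a c d → s :* (a :* (c :* d)) := s :* (a :* c) :* d) refl (sign j) (A zero j) _ (det D))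
    right : ∀ j → sign (suc m ↑ʳ j) * (K zero (suc m ↑ʳ j) * det (λ a b → K (suc a) (punchIn (suc m ↑ʳ j) b))) ≈ 0#
    right j rewrite Fin.splitAt-↑ʳ m n j = trans (*-congˡ (zeroˡ _)) (zeroʳ _)

  det-scalar : ∀ n δ → det {n} (λ i j → δ * 𝟏 i j) ≈ δ ^ n
  det-scalar zero    δ = det-zero _
  det-scalar (suc n) δ = trans (det-suc _) (trans (∑-suc _) (trans
    (+-cong
      (trans (*-identityˡ _) (*-cong (*-identityʳ δ) (det-scalar n δ)))
      (∑-0 λ j → trans (*-congˡ (trans (*-congʳ (zeroʳ δ)) (zeroˡ _))) (zeroʳ _)))
    (+-identityʳ _)))

  -- A Schur complement without inverting `δ`: the top rows are multiplied by `δ`, which costs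
  -- `δ ^ m`, and B times the bottom rows is then subtracted. The upper right block becomes δB - Bδ
  -- = 0.
  det-scalarBlock : ∀ δ (P : Matrix Carrier m) (B : Fin m → Fin n → Carrier) (C : Fin n → Fin m → Carrier) →
    δ ^ m * det (block P B C λ i j → δ * 𝟏 i j) ≈ δ ^ n * det λ i j → δ * P i j - ∑ λ l → B i l * C l j
  det-scalarBlock {m} {n} δ P B C = begin
    δ ^ m * det (block P B C D)
      ≈⟨ det-rows δ (λ i l → - B i l) (λ i → stack (P i) (B i)) (λ i → stack (C i) (D i)) ⟨
    det (stack (λ i j → δ * stack (P i) (B i) j + ∑ λ l → - B i l * stack (C l) (D l) j) (λ i → stack (C i) (D i)))
      ≈⟨ det-cong cleared ⟩
    det (block (λ i j → δ * P i j - ∑ λ l → B i l * C l j) (λ _ _ → 0#) C D)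
      ≈⟨ det-lowerBlock _ C D ⟩
    det (λ i j → δ * P i j - ∑ λ l → B i l * C l j) * det D
      ≈⟨ trans (*-congˡ (det-scalar n δ)) (*-comm _ _) ⟩
    δ ^ n * det (λ i j → δ * P i j - ∑ λ l → B i l * C l j) ∎
    where
    D : Matrix Carrier n
    D i j = δ * 𝟏 i j
    neg-out : ∀ (f g : Fin n → Carrier) → ∑ (λ l → - f l * g l) ≈ - ∑ λ l → f l * g l
    neg-out f g = trans (∑-cong λ l → sym (-‿distribˡ-* (f l) (g l))) (∑-neg _)
    cleared : ∀ i j →
      stack (λ i j → δ * stack (P i) (B i) j + ∑ λ l → - B i l * stack (C l) (D l) j) (λ i → stack (C i) (D i)) i j
      ≈ block (λ i j → δ * P i j - ∑ λ l → B i l * C l j) (λ _ _ → 0#) C D i j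
    cleared i j with splitAt m i
    cleared i j | inj₁ a with splitAt m j
    ... | inj₁ b = +-congˡ (neg-out (B a) (λ l → C l b))
    ... | inj₂ b = trans (+-congˡ (trans (neg-out (B a) (λ l → δ * 𝟏 l b)) (-‿cong (trans
            (∑-cong λ l → trans (sym (*-assoc _ _ _)) (*-congʳ (*-comm _ δ)))
            (∑-select (λ l → δ * B a l) b)))))
          (-‿inverseʳ _)
    cleared i j | inj₂ a = refl

  -- Both sides are the determinant of the block matrix with rows (1 N) and
  -- (M y1), eliminated from either corner.
  sylvester : ∀ y (M : Fin m → Fin n → Carrier) (N : Fin n → Fin m → Carrier) →
    y ^ n * det (λ i j → y * 𝟏 i j - ∑ λ l → M i l * N l j)
    ≈ y ^ m * det (λ i j → y * 𝟏 i j - ∑ λ l → N i l * M l j)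
  sylvester {m} {n} y M N = trans
    (*-congˡ (sym (det-unitBlock N M λ i j → y * 𝟏 i j)))
    (det-scalarBlock y 𝟏 N M)

-- Line graphs

pairs-∈ : (xs : List A) {a b : A} → (a , b) ∈ pairs xs → a ∈ xs × b ∈ xs
pairs-∈ (x ∷ xs) ab∈ with ∈-++⁻ (map (x ,_) xs) ab∈
... | inj₁ ab∈l with ∈-map⁻ (x ,_) ab∈l
...   | _ , b∈ , ≡.refl = here ≡.refl , there b∈
pairs-∈ (x ∷ xs) ab∈ | inj₂ ab∈r with pairs-∈ xs ab∈r
...   | a∈ , b∈ = there a∈ , there b∈

-- An edge must not be stored in both orientations: these would be two distinct pairs sharing both
-- endpoints, and two distinct edges could meet twice.
pairs-asym : {xs : List A} → Unique xs → ∀ {a b} → (a , b) ∈ pairs xs → ¬ (b , a) ∈ pairs xs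
pairs-asym {xs = x ∷ xs} (x∉xs AllPairs.∷ xs!) ab∈ ba∈
  with ∈-++⁻ (map (x ,_) xs) ab∈ | ∈-++⁻ (map (x ,_) xs) ba∈
... | inj₂ ab∈r | inj₂ ba∈r = pairs-asym xs! ab∈r ba∈r
... | inj₁ ab∈l | inj₁ ba∈l with ∈-map⁻ (x ,_) ab∈l | ∈-map⁻ (x ,_) ba∈l
...   | _ , b∈ , ≡.refl | _ , _ , ≡.refl = All.lookup x∉xs b∈ ≡.refl
pairs-asym {xs = x ∷ xs} (x∉xs AllPairs.∷ xs!) ab∈ ba∈
    | inj₁ ab∈l | inj₂ ba∈r with ∈-map⁻ (x ,_) ab∈l
...   | _ , _ , ≡.refl = All.lookup x∉xs (proj₂ (pairs-∈ xs ba∈r)) ≡.refl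
pairs-asym {xs = x ∷ xs} (x∉xs AllPairs.∷ xs!) ab∈ ba∈
    | inj₂ ab∈r | inj₁ ba∈l with ∈-map⁻ (x ,_) ba∈l
...   | _ , _ , ≡.refl = All.lookup x∉xs (proj₂ (pairs-∈ xs ab∈r)) ≡.refl

lookup-injective : {xs : List A} → Unique xs → ∀ {i j} → lookup xs i ≡ lookup xs j → i ≡ j
lookup-injective {xs = x ∷ xs} _ {zero} {zero} eq = ≡.refl
lookup-injective {xs = x ∷ xs} (x∉xs AllPairs.∷ _) {zero} {suc j} eq =
  contradiction eq (All.lookup x∉xs (∈-lookup {xs = xs} j))
lookup-injective {xs = x ∷ xs} (x∉xs AllPairs.∷ _) {suc i} {zero} eq =
  contradiction (≡.sym eq) (All.lookup x∉xs (∈-lookup {xs = xs} i))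
lookup-injective {xs = x ∷ xs} (_ AllPairs.∷ xs!) {suc i} {suc j} eq = ≡.cong suc (lookup-injective xs! eq)

-- Sums over lists

module ListSums (R : CommutativeRing 0ℓ 0ℓ) where
  open CommutativeRing R hiding (zero)
  open Sums R
  open import Relation.Binary.Reasoning.Setoid setoid

  -- The Iverson bracket. Since it inspects only `does`, it computes through the decision
  -- combinators from which adjacency is built.
  ⟦_⟧ : {P : Set} → Dec P → Carrier
  ⟦ d ⟧ = if does d then 1# else 0#

  ⟦⟧-true : {P : Set} (d : Dec P) → P → ⟦ d ⟧ ≈ 1#
  ⟦⟧-true d p rewrite dec-true d p = refl

  ⟦⟧-false : {P : Set} (d : Dec P) → ¬ P → ⟦ d ⟧ ≈ 0#
  ⟦⟧-false d ¬p rewrite dec-false d ¬p = refl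

  ⟦⟧-cong : {P Q : Set} (d : Dec P) (e : Dec Q) → (P → Q) → (Q → P) → ⟦ d ⟧ ≈ ⟦ e ⟧
  ⟦⟧-cong d (yes q) P→Q Q→P = ⟦⟧-true d (Q→P q)
  ⟦⟧-cong d (no ¬q) P→Q Q→P = ⟦⟧-false d (¬q ∘ P→Q)

  ∑ₗ : List A → (A → Carrier) → Carrier
  ∑ₗ xs f = ∑ λ i → f (lookup xs i)

  ∑ₗ-++ : ∀ xs ys (f : A → Carrier) → ∑ₗ (xs ++ ys) f ≈ ∑ₗ xs f + ∑ₗ ys f
  ∑ₗ-++ []       ys f = sym (trans (+-congʳ (∑-zero _)) (+-identityˡ _))
  ∑ₗ-++ (x ∷ xs) ys f = trans (∑-suc _) (trans (+-congˡ (∑ₗ-++ xs ys f))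
    (trans (sym (+-assoc _ _ _)) (+-congʳ (sym (∑-suc _)))))

  ∑ₗ-map : ∀ (g : A → B) xs (f : B → Carrier) → ∑ₗ (map g xs) f ≈ ∑ₗ xs (f ∘ g)
  ∑ₗ-map g []       f = trans (∑-zero _) (sym (∑-zero _))
  ∑ₗ-map g (x ∷ xs) f = trans (∑-suc _) (trans (+-congˡ (∑ₗ-map g xs f)) (sym (∑-suc _)))

  ∑ₗ-filter : {P : Pred A 0ℓ} (P? : Decidable P) (xs : List A) (f : A → Carrier) →
    ∑ₗ (filter P? xs) f ≈ ∑ₗ xs λ x → ⟦ P? x ⟧ * f x
  ∑ₗ-filter P? []       f = trans (∑-zero _) (sym (∑-zero _))
  ∑ₗ-filter P? (x ∷ xs) f = trans step (sym (∑-suc _))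
    where
    step : ∑ₗ (filter P? (x ∷ xs)) f ≈ ⟦ P? x ⟧ * f x + ∑ₗ xs λ x → ⟦ P? x ⟧ * f x
    step with does (P? x)
    ... | true  = trans (∑-suc _) (+-cong (sym (*-identityˡ _)) (∑ₗ-filter P? xs f))
    ... | false = trans (∑ₗ-filter P? xs f) (sym (trans (+-congʳ (zeroˡ _)) (+-identityˡ _)))

  ∑ₗ-support : {P : Pred A 0ℓ} (P? : Decidable P) (xs : List A) (f : A → Carrier) →
    (∀ x → ¬ P x → f x ≈ 0#) → ∑ₗ (filter P? xs) f ≈ ∑ₗ xs f
  ∑ₗ-support {P = P} P? xs f f≈0 = trans (∑ₗ-filter P? xs f) (∑-cong λ i → absorb (lookup xs i) (P? (lookup xs i)))
    where
    absorb : ∀ x (d : Dec (P x)) → ⟦ d ⟧ * f x ≈ f x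
    absorb x (yes _) = *-identityˡ _
    absorb x (no ¬p) = trans (zeroˡ _) (sym (f≈0 x ¬p))

  ∑ₗ-select : (_≟_ : DecidableEquality A) {xs : List A} → Unique xs → ∀ {a} → a ∈ xs → (g : A → Carrier) →
    ∑ₗ xs (λ x → ⟦ a ≟ x ⟧ * g x) ≈ g a
  ∑ₗ-select _≟_ (x∉xs AllPairs.∷ xs!) {a} (here ≡.refl) g = trans (∑-suc _) (trans
    (+-cong (trans (*-congʳ (⟦⟧-true (a ≟ a) ≡.refl)) (*-identityˡ _))
      (∑-0 λ i → trans (*-congʳ (⟦⟧-false (a ≟ _) (All.lookup x∉xs (∈-lookup i)))) (zeroˡ _)))
    (+-identityʳ _))
  ∑ₗ-select _≟_ (x∉xs AllPairs.∷ xs!) {a} (there a∈) g = trans (∑-suc _) (trans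
    (+-cong (trans (*-congʳ (⟦⟧-false (a ≟ _) λ a≡x → All.lookup x∉xs a∈ (≡.sym a≡x))) (zeroˡ _))
      (∑ₗ-select _≟_ xs! a∈ g))
    (+-identityˡ _))

  -- Each listed pair, read in its two directions, accounts for two off-diagonal terms of the double
  -- sum; the diagonal contributes 0.
  ∑ₗ-pairs : ∀ xs (h : A → A → Carrier) → (∀ x → h x x ≈ 0#) →
    ∑ₗ (pairs xs) (λ (x , y) → h x y + h y x) ≈ ∑ₗ xs λ x → ∑ₗ xs λ y → h x y
  ∑ₗ-pairs []       h h-irrefl = trans (∑-zero _) (sym (∑-zero _))
  ∑ₗ-pairs (x ∷ xs) h h-irrefl = begin
    ∑ₗ (pairs (x ∷ xs)) h²
      ≈⟨ ∑ₗ-++ (map (x ,_) xs) (pairs xs) h² ⟩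
    ∑ₗ (map (x ,_) xs) h² + ∑ₗ (pairs xs) h²
      ≈⟨ +-cong (trans (∑ₗ-map (x ,_) xs h²) (∑-+ _ _)) (∑ₗ-pairs xs h h-irrefl) ⟩
    (∑ₗ xs (h x) + ∑ₗ xs (flip h x)) + ∑ₗ xs (λ u → ∑ₗ xs (h u))
      ≈⟨ +-assoc _ _ _ ⟩
    ∑ₗ xs (h x) + (∑ₗ xs (flip h x) + ∑ₗ xs (λ u → ∑ₗ xs (h u)))
      ≈⟨ +-cong (sym (trans (∑-suc _) (trans (+-congʳ (h-irrefl x)) (+-identityˡ _)))) (sym (∑-+ _ _)) ⟩
    ∑ₗ (x ∷ xs) (h x) + ∑ₗ xs (λ u → h u x + ∑ₗ xs (h u))
      ≈⟨ +-congˡ (∑-cong λ i → ∑-suc _) ⟨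
    ∑ₗ (x ∷ xs) (h x) + ∑ₗ xs (λ u → ∑ₗ (x ∷ xs) (h u))
      ≈⟨ ∑-suc _ ⟨
    ∑ₗ (x ∷ xs) (λ u → ∑ₗ (x ∷ xs) (h u)) ∎
    where
    h² : _ → Carrier
    h² (x , y) = h x y + h y x

-- The incidence matrix of a graph

module LineGraphs (R : CommutativeRing 0ℓ 0ℓ) (G : Graph) where
  open CommutativeRing R hiding (zero)
  open Algebra.Properties.Semiring.Exp semiring using (_^_)
  open Sums R
  open ListSums R
  open Determinants R
  open BlockDeterminants R
  open Graph G
  open import Relation.Binary.Reasoning.Setoid setoid
  open import Algebra.Solver.Ring.NaturalCoefficients.Default commutativeSemiring
    using (solve; _:+_; _:*_; _:=_)
  private module L = Graph (lineGraph G)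

  private
    E : ℕ
    E = length (edges G)

    edge : Fin E → V × V
    edge = lookup (edges G)

  incidence : V → V × V → Carrier
  incidence v (a , b) = ⟦ v ≟ a ⟧ + ⟦ v ≟ b ⟧

  degree : V → Carrier
  degree v = ∑ₗ vertices λ b → ⟦ adj? v b ⟧

  edge-adj : ∀ {a b} → (a , b) ∈ edges G → Adj a b
  edge-adj ab∈ = proj₂ (∈-filter⁻ (λ (u , v) → adj? u v) {xs = pairs vertices} ab∈)

  edge∈pairs : ∀ {e} → e ∈ edges G → e ∈ pairs vertices
  edge∈pairs e∈ = proj₁ (∈-filter⁻ (λ (u , v) → adj? u v) {xs = pairs vertices} e∈)

  -- Distinct edges of a simple graph share at most one endpoint, so of the four possible
  -- coincidences at most one holds and their number is the adjacency entry.
  incidence-distinct : ∀ {e f} → e ∈ edges G → f ∈ edges G → e ≢ f →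
    incidence (proj₁ e) f + incidence (proj₂ e) f ≈ ⟦ L.adj? e f ⟧
  incidence-distinct {e@(a , b)} {f@(c , d)} e∈ f∈ e≢f = count (a ≟ c) (a ≟ d) (b ≟ c) (b ≟ d) (e L.≟ f)
    where
    a≢b : a ≢ b
    a≢b a≡b = irrefl a≡b (edge-adj e∈)
    c≢d : c ≢ d
    c≢d c≡d = irrefl c≡d (edge-adj f∈)
    count : (p : Dec (a ≡ c)) (q : Dec (a ≡ d)) (r : Dec (b ≡ c)) (s : Dec (b ≡ d)) (t : Dec (e ≡ f)) →
      (⟦ p ⟧ + ⟦ q ⟧) + (⟦ r ⟧ + ⟦ s ⟧) ≈
      (if not (does t) ∧ ((does p ∨ does q) ∨ (does r ∨ does s)) then 1# else 0#)
    count _ _ _ _ (yes e≡f) = contradiction e≡f e≢f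
    count (yes ≡.refl) (yes ≡.refl) _ _ _ = contradiction ≡.refl c≢d
    count (yes ≡.refl) _ (yes ≡.refl) _ _ = contradiction ≡.refl a≢b
    count (yes ≡.refl) _ _ (yes ≡.refl) _ = contradiction ≡.refl e≢f
    -- Here `f` would be `e` reversed.
    count _ (yes ≡.refl) (yes ≡.refl) _ _ =
      contradiction (edge∈pairs f∈) (pairs-asym unique (edge∈pairs e∈))
    count _ (yes ≡.refl) _ (yes ≡.refl) _ = contradiction ≡.refl a≢b
    count _ _ (yes ≡.refl) (yes ≡.refl) _ = contradiction ≡.refl c≢d
    count (yes _) (no _) (no _) (no _) (no _) = trans (+-cong (+-identityʳ _) (+-identityʳ _)) (+-identityʳ _)
    count (no _) (yes _) (no _) (no _) (no _) = trans (+-cong (+-identityˡ _) (+-identityʳ _)) (+-identityʳ _)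
    count (no _) (no _) (yes _) (no _) (no _) = trans (+-cong (+-identityʳ _) (+-identityʳ _)) (+-identityˡ _)
    count (no _) (no _) (no _) (yes _) (no _) = trans (+-cong (+-identityʳ _) (+-identityˡ _)) (+-identityˡ _)
    count (no _) (no _) (no _) (no _) (no _) = trans (+-cong (+-identityʳ _) (+-identityʳ _)) (+-identityʳ _)

  incidence-same : ∀ {e} → e ∈ edges G →
    incidence (proj₁ e) e + incidence (proj₂ e) e ≈ 1# + 1#
  incidence-same {a , b} e∈ = +-cong
    (trans (+-cong (⟦⟧-true (a ≟ a) ≡.refl) (⟦⟧-false (a ≟ b) λ a≡b → irrefl a≡b (edge-adj e∈))) (+-identityʳ _))
    (trans (+-cong (⟦⟧-false (b ≟ a) λ b≡a → irrefl (≡.sym b≡a) (edge-adj e∈)) (⟦⟧-true (b ≟ b) ≡.refl)) (+-identityˡ _))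

  edges-through : ∀ {v w} → v ∈ vertices → w ∈ vertices →
    ∑ₗ (edges G) (λ e → incidence v e * incidence w e) ≈ ⟦ w ≟ v ⟧ * degree v + ⟦ adj? v w ⟧
  edges-through {v} {w} v∈ w∈ = begin
    ∑ₗ (edges G) (λ e → incidence v e * incidence w e)
      ≈⟨ ∑ₗ-filter (λ (a , b) → adj? a b) (pairs vertices) (λ e → incidence v e * incidence w e) ⟩
    ∑ₗ (pairs vertices) (λ (a , b) → ⟦ adj? a b ⟧ * (incidence v (a , b) * incidence w (a , b)))
      ≈⟨ ∑-cong (λ i → oriented (lookup (pairs vertices) i)) ⟩
    ∑ₗ (pairs vertices) (λ (a , b) → h a b + h b a)
      ≈⟨ ∑ₗ-pairs vertices h (λ a → trans (*-congˡ (trans (*-congʳ (⟦⟧-false (adj? a a) (irrefl ≡.refl))) (zeroˡ _))) (zeroʳ _)) ⟩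
    ∑ₗ vertices (λ a → ∑ₗ vertices λ b → h a b)
      ≈⟨ ∑-cong (λ i → sym (*-distribˡ-∑ ⟦ v ≟ lookup vertices i ⟧ _)) ⟩
    ∑ₗ vertices (λ a → ⟦ v ≟ a ⟧ * ∑ₗ vertices λ b → ⟦ adj? a b ⟧ * incidence w (a , b))
      ≈⟨ ∑ₗ-select _≟_ unique v∈ (λ a → ∑ₗ vertices λ b → ⟦ adj? a b ⟧ * incidence w (a , b)) ⟩
    ∑ₗ vertices (λ b → ⟦ adj? v b ⟧ * (⟦ w ≟ v ⟧ + ⟦ w ≟ b ⟧))
      ≈⟨ trans (∑-cong λ i → distribˡ _ _ _) (∑-+ _ _) ⟩
    ∑ₗ vertices (λ b → ⟦ adj? v b ⟧ * ⟦ w ≟ v ⟧) + ∑ₗ vertices (λ b → ⟦ adj? v b ⟧ * ⟦ w ≟ b ⟧)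
      ≈⟨ +-cong (trans (sym (*-distribʳ-∑ ⟦ w ≟ v ⟧ _)) (*-comm _ _))
           (trans (∑-cong λ i → *-comm _ _) (∑ₗ-select _≟_ unique w∈ λ b → ⟦ adj? v b ⟧)) ⟩
    ⟦ w ≟ v ⟧ * degree v + ⟦ adj? v w ⟧ ∎
    where
    h : V → V → Carrier
    h a b = ⟦ v ≟ a ⟧ * (⟦ adj? a b ⟧ * incidence w (a , b))
    oriented : ∀ ((a , b) : V × V) →
      ⟦ adj? a b ⟧ * (incidence v (a , b) * incidence w (a , b)) ≈ h a b + h b a
    oriented (a , b) = trans
      (solve 4 (λ s x y i → s :* ((x :+ y) :* i) := x :* (s :* i) :+ y :* (s :* i)) refl
        ⟦ adj? a b ⟧ ⟦ v ≟ a ⟧ ⟦ v ≟ b ⟧ (incidence w (a , b)))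
      (+-congˡ (*-congˡ (*-cong (⟦⟧-cong (adj? a b) (adj? b a) symm symm) (+-comm _ _))))

  handshake : ∑ₗ (edges G) (λ _ → 1# + 1#) ≈ ∑ₗ vertices degree
  handshake = begin
    ∑ₗ (edges G) (λ _ → 1# + 1#)
      ≈⟨ ∑ₗ-filter (λ (a , b) → adj? a b) (pairs vertices) (λ _ → 1# + 1#) ⟩
    ∑ₗ (pairs vertices) (λ (a , b) → ⟦ adj? a b ⟧ * (1# + 1#))
      ≈⟨ ∑-cong (λ i → oriented (lookup (pairs vertices) i)) ⟩
    ∑ₗ (pairs vertices) (λ (a , b) → ⟦ adj? a b ⟧ + ⟦ adj? b a ⟧)
      ≈⟨ ∑ₗ-pairs vertices (λ a b → ⟦ adj? a b ⟧) (λ a → ⟦⟧-false (adj? a a) (irrefl ≡.refl)) ⟩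
    ∑ₗ vertices degree ∎
    where
    oriented : ∀ ((a , b) : V × V) → ⟦ adj? a b ⟧ * (1# + 1#) ≈ ⟦ adj? a b ⟧ + ⟦ adj? b a ⟧
    oriented (a , b) = trans (distribˡ _ _ _) (+-cong (*-identityʳ _)
      (trans (*-identityʳ _) (⟦⟧-cong (adj? a b) (adj? b a) symm symm)))

  -- Two Gram matrices of the incidence matrix: adjacency of the line graph plus
  -- 2 on one side, degrees plus adjacency of G on the other.
  lineGraph-det : ∀ y (vs : Fin m → V) → (∀ i → vs i ∈ vertices) →
    (∀ {a} → a ∈ vertices → (g : V → Carrier) → ∑ (λ i → ⟦ vs i ≟ a ⟧ * g (vs i)) ≈ g a) →
    y ^ m * det (λ (i j : Fin E) → y * 𝟏 i j - (⟦ L.adj? (edge i) (edge j) ⟧ + (1# + 1#) * 𝟏 i j))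
    ≈ y ^ E * det (λ i j → y * 𝟏 i j - (⟦ vs j ≟ vs i ⟧ * degree (vs i) + ⟦ adj? (vs i) (vs j) ⟧))
  lineGraph-det {m} y vs vs∈ select = begin
    y ^ m * det (λ (i j : Fin E) → y * 𝟏 i j - (⟦ L.adj? (edge i) (edge j) ⟧ + (1# + 1#) * 𝟏 i j))
      ≈⟨ *-congˡ (det-cong λ i j → +-congˡ (-‿cong (gram i j))) ⟨
    y ^ m * det (λ (i j : Fin E) → y * 𝟏 i j - ∑ λ l → incidence (vs l) (edge i) * incidence (vs l) (edge j))
      ≈⟨ sylvester y (λ i l → incidence (vs l) (edge i)) (λ l j → incidence (vs l) (edge j)) ⟩
    y ^ E * det (λ i j → y * 𝟏 i j - ∑ λ e → incidence (vs i) (edge e) * incidence (vs j) (edge e))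
      ≈⟨ *-congˡ (det-cong λ i j → +-congˡ (-‿cong (edges-through (vs∈ i) (vs∈ j)))) ⟩
    y ^ E * det (λ i j → y * 𝟏 i j - (⟦ vs j ≟ vs i ⟧ * degree (vs i) + ⟦ adj? (vs i) (vs j) ⟧)) ∎
    where
    both-ends : ∀ e f → e ∈ edges G →
      ∑ (λ l → incidence (vs l) e * incidence (vs l) f) ≈ incidence (proj₁ e) f + incidence (proj₂ e) f
    both-ends (a , b) f e∈ = trans (∑-cong λ l → distribʳ _ _ _) (trans (∑-+ _ _)
      (+-cong (select (proj₁ (pairs-∈ vertices (edge∈pairs e∈))) λ v → incidence v f)
              (select (proj₂ (pairs-∈ vertices (edge∈pairs e∈))) λ v → incidence v f)))
    edges! : Unique (edges G)
    edges! = L.unique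
    gram : ∀ i j → ∑ (λ l → incidence (vs l) (edge i) * incidence (vs l) (edge j))
      ≈ ⟦ L.adj? (edge i) (edge j) ⟧ + (1# + 1#) * 𝟏 i j
    gram i j = trans (both-ends (edge i) (edge j) (∈-lookup i)) (diagonal (i Fin.≟ j))
      where
      diagonal : (d : Dec (i ≡ j)) → incidence (proj₁ (edge i)) (edge j) + incidence (proj₂ (edge i)) (edge j)
        ≈ ⟦ L.adj? (edge i) (edge j) ⟧ + (1# + 1#) * ⟦ d ⟧
      diagonal (yes ≡.refl) = trans (incidence-same (∈-lookup i)) (sym (trans
        (+-cong (⟦⟧-false (L.adj? (edge i) (edge i)) (L.irrefl ≡.refl)) (*-identityʳ _)) (+-identityˡ _)))
      diagonal (no i≢j) = trans
        (incidence-distinct (∈-lookup i) (∈-lookup j) (i≢j ∘ lookup-injective edges!))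
        (sym (trans (+-congˡ (zeroʳ _)) (+-identityʳ _)))

-- The Boolean lattice

_≟ₛ_ : DecidableEquality (Subset n)
_≟ₛ_ = Vec.≡-dec Bool._≟_

∣p△q∣≡0⇒p≡q : (p q : Subset n) → ∣ p △ q ∣ ≡ 0 → p ≡ q
∣p△q∣≡0⇒p≡q []          []          eq = ≡.refl
∣p△q∣≡0⇒p≡q (false ∷ p) (false ∷ q) eq = ≡.cong (false ∷_) (∣p△q∣≡0⇒p≡q p q eq)
∣p△q∣≡0⇒p≡q (true ∷ p)  (true ∷ q)  eq = ≡.cong (true ∷_) (∣p△q∣≡0⇒p≡q p q eq)

level : ∀ n → ℕ → List (Subset n)
level n j = filter (λ p → ∣ p ∣ ℕ.≟ j) (subsets n)

level-size : ∀ {j} {p : Subset n} → p ∈ level n j → ∣ p ∣ ≡ j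
level-size {n} {j} p∈ = proj₂ (∈-filter⁻ (λ p → ∣ p ∣ ℕ.≟ j) {xs = subsets n} p∈)

level! : ∀ n j → Unique (level n j)
level! n j = Unique.filter⁺ (λ p → ∣ p ∣ ℕ.≟ j) (subsets-unique n)

size : ∀ n j (a : Fin (length (level n j))) → ∣ lookup (level n j) a ∣ ≡ j
size n j a = level-size (∈-lookup {xs = level n j} a)

module BooleanLattice (R : CommutativeRing 0ℓ 0ℓ) where
  open CommutativeRing R hiding (zero)
  open Algebra.Properties.Ring ring using (-0#≈0#; [y-z]x≈yx-zx; -‿+-comm)
  open Algebra.Properties.Semiring.Exp semiring using (_^_)
  open Algebra.Definitions.RawMonoid (RawRing.+-rawMonoid rawRing) using () renaming (_×_ to _×ₘ_)
  open Sums R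
  open ListSums R
  open Determinants R
  open BlockDeterminants R
  open import Relation.Binary.Reasoning.Setoid setoid
  open import Algebra.Solver.Ring.NaturalCoefficients.Default commutativeSemiring
    using (solve; _:+_; _:*_; _:=_; con)

  ι : ℕ → Carrier
  ι n = n ×ₘ 1#

  ∑ₗ-const : ∀ {A : Set} (xs : List A) c → ∑ₗ xs (λ _ → c) ≈ ι (length xs) * c
  ∑ₗ-const []       c = trans (∑-zero _) (sym (zeroˡ c))
  ∑ₗ-const (x ∷ xs) c = trans (∑-suc _) (trans (+-cong (sym (*-identityˡ c)) (∑ₗ-const xs c)) (sym (distribʳ c _ _)))

  opaque
    -- Sums over all subsets split along the first element, so identities follow by induction on n
    -- without tracking sizes. `∑-level` converts them into sums over one level when the summand is
    -- supported there.
    ∑ₛ : (Subset n → Carrier) → Carrier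
    ∑ₛ = ∑ₗ (subsets _)

    ∑ₛ≡∑ₗ : (f : Subset n → Carrier) → ∑ₛ f ≡ ∑ₗ (subsets n) f
    ∑ₛ≡∑ₗ f = ≡.refl

    ∑ₛ-cong : {f g : Subset n → Carrier} → (∀ r → f r ≈ g r) → ∑ₛ f ≈ ∑ₛ g
    ∑ₛ-cong f≈g = ∑-cong λ i → f≈g _

    ∑ₛ-0 : {f : Subset n → Carrier} → (∀ r → f r ≈ 0#) → ∑ₛ f ≈ 0#
    ∑ₛ-0 f≈0 = ∑-0 λ i → f≈0 _

    ∑ₛ-[] : (f : Subset 0 → Carrier) → ∑ₛ f ≈ f []
    ∑ₛ-[] f = trans (∑-suc _) (trans (+-congˡ (∑-zero _)) (+-identityʳ _))

    ∑ₛ-∷ : (f : Subset (suc n) → Carrier) → ∑ₛ f ≈ ∑ₛ (λ r → f (false ∷ r)) + ∑ₛ (λ r → f (true ∷ r))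
    ∑ₛ-∷ {n} f = trans (∑ₗ-++ (map (false ∷_) (subsets n)) _ f)
      (+-cong (∑ₗ-map (false ∷_) (subsets n) f) (∑ₗ-map (true ∷_) (subsets n) f))

    ∑-level : ∀ j (f : Subset n → Carrier) → (∀ r → ∣ r ∣ ≢ j → f r ≈ 0#) → ∑ₗ (level n j) f ≈ ∑ₛ f
    ∑-level {n} j f f≈0 = ∑ₗ-support (λ p → ∣ p ∣ ℕ.≟ j) (subsets n) f f≈0

  δ : Subset n → Subset n → Carrier
  δ p q = ⟦ p ≟ₛ q ⟧

  δ-sym : (p q : Subset n) → δ p q ≈ δ q p
  δ-sym p q = ⟦⟧-cong (p ≟ₛ q) (q ≟ₛ p) ≡.sym ≡.sym

  ∑ₛ-selectˡ : (p : Subset n) (g : Subset n → Carrier) → ∑ₛ (λ r → δ p r * g r) ≈ g p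
  ∑ₛ-selectˡ {n} p g = trans (reflexive (∑ₛ≡∑ₗ λ r → δ p r * g r)) (∑ₗ-select _≟ₛ_ (subsets-unique n) (subsets-complete p) g)

  ∑ₛ-selectʳ : (p : Subset n) (g : Subset n → Carrier) → ∑ₛ (λ r → δ r p * g r) ≈ g p
  ∑ₛ-selectʳ p g = trans (∑ₛ-cong λ i → *-congʳ (δ-sym _ p)) (∑ₛ-selectˡ p g)

  ∑ₛ-δˡ : (p : Subset n) → ∑ₛ (λ r → δ p r) ≈ 1#
  ∑ₛ-δˡ p = trans (∑ₛ-cong λ i → sym (*-identityʳ _)) (∑ₛ-selectˡ p λ _ → 1#)

  ∑ₛ-δʳ : (p : Subset n) → ∑ₛ (λ r → δ r p) ≈ 1#
  ∑ₛ-δʳ p = trans (∑ₛ-cong λ i → δ-sym _ p) (∑ₛ-δˡ p)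

  -- The indicator of p ⊂ q with |q| = |p| + 1.
  cov : Subset n → Subset n → Carrier
  cov []          []          = 0#
  cov (false ∷ p) (false ∷ q) = cov p q
  cov (false ∷ p) (true ∷ q)  = δ p q
  cov (true ∷ p)  (false ∷ q) = 0#
  cov (true ∷ p)  (true ∷ q)  = cov p q

  cov-graded : (p q : Subset n) → suc ∣ p ∣ ≢ ∣ q ∣ → cov p q ≈ 0#
  cov-graded []          []          _ = refl
  cov-graded (false ∷ p) (false ∷ q) ≢ = cov-graded p q ≢
  cov-graded (false ∷ p) (true ∷ q)  ≢ = ⟦⟧-false (p ≟ₛ q) λ p≡q → ≢ (≡.cong (suc ∘ ∣_∣) p≡q)
  cov-graded (true ∷ p)  (false ∷ q) ≢ = refl
  cov-graded (true ∷ p)  (true ∷ q)  ≢ = cov-graded p q (≢ ∘ ≡.cong suc)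

  adj-cov : (p q : Subset n) → ⟦ ∣ p △ q ∣ ℕ.≟ 1 ⟧ ≈ cov p q + cov q p
  adj-cov []          []          = sym (+-identityˡ _)
  adj-cov (false ∷ p) (false ∷ q) = adj-cov p q
  adj-cov (true ∷ p)  (true ∷ q)  = adj-cov p q
  adj-cov (false ∷ p) (true ∷ q)  = trans
    (⟦⟧-cong (∣ p △ q ∣ ℕ.≟ 0) (p ≟ₛ q) (∣p△q∣≡0⇒p≡q p q) λ { ≡.refl → ∣p△p∣≡0 p })
    (sym (+-identityʳ _))
  adj-cov (true ∷ p)  (false ∷ q) = trans
    (⟦⟧-cong (∣ p △ q ∣ ℕ.≟ 0) (q ≟ₛ p) (≡.sym ∘ ∣p△q∣≡0⇒p≡q p q) λ { ≡.refl → ∣p△p∣≡0 p })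
    (sym (+-identityˡ _))

  up-degree : (p : Subset n) → ∑ₛ (λ r → cov p r) + ι ∣ p ∣ ≈ ι n
  up-degree [] = trans (+-identityʳ _) (∑ₛ-[] _)
  up-degree (false ∷ p) = trans
    (+-congʳ (trans (∑ₛ-∷ (cov (false ∷ p))) (+-congˡ (∑ₛ-δˡ p))))
    (trans (trans (+-congʳ (+-comm _ _)) (+-assoc _ _ _)) (+-congˡ (up-degree p)))
  up-degree (true ∷ p) = trans
    (+-congʳ (trans (∑ₛ-∷ (cov (true ∷ p))) (trans (+-congʳ (∑ₛ-0 λ _ → refl)) (+-identityˡ _))))
    (trans (trans (sym (+-assoc _ _ _)) (trans (+-congʳ (+-comm _ _)) (+-assoc _ _ _))) (+-congˡ (up-degree p)))

  down-degree : (p : Subset n) → ∑ₛ (λ r → cov r p) ≈ ι ∣ p ∣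
  down-degree [] = ∑ₛ-[] _
  down-degree (false ∷ p) = trans (∑ₛ-∷ (λ r → cov r (false ∷ p)))
    (trans (+-cong (down-degree p) (∑ₛ-0 λ _ → refl)) (+-identityʳ _))
  down-degree (true ∷ p) = trans (∑ₛ-∷ (λ r → cov r (true ∷ p)))
    (+-cong (∑ₛ-δʳ p) (down-degree p))

  -- The commutation relation of the up and down operators, DU - UD = n - 2|p|, with negative terms
  -- moved across. For p ≠ q, a common cover can only be the union and a common lower neighbour only
  -- the intersection, and one exists exactly when the other does. For p = q the counts are n - |p|
  -- and |p|.
  up-down : (p q : Subset n) →
    ∑ₛ (λ r → cov p r * cov q r) + (ι ∣ p ∣ + ι ∣ p ∣) * δ p q
    ≈ ∑ₛ (λ r → cov r p * cov r q) + ι n * δ p q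
  up-down [] [] = +-cong (trans (∑ₛ-[] _) (sym (∑ₛ-[] _))) (*-congʳ (+-identityʳ 0#))
  up-down {suc n} (false ∷ p) (false ∷ q) = begin
    ∑ₛ (λ r → cov (false ∷ p) r * cov (false ∷ q) r) + x * δ p q
      ≈⟨ +-congʳ (trans (∑ₛ-∷ _) (+-congˡ (trans (∑ₛ-selectˡ p (δ q)) (δ-sym q p)))) ⟩
    (∑ₛ (λ r → cov p r * cov q r) + δ p q) + x * δ p q
      ≈⟨ solve 3 (λ u d x → (u :+ d) :+ x :* d := (u :+ x :* d) :+ d) refl (∑ₛ λ r → cov p r * cov q r) (δ p q) x ⟩
    (∑ₛ (λ r → cov p r * cov q r) + x * δ p q) + δ p q
      ≈⟨ +-congʳ (up-down p q) ⟩
    (∑ₛ (λ r → cov r p * cov r q) + ι n * δ p q) + δ p q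
      ≈⟨ solve 3 (λ u d x → (u :+ x :* d) :+ d := (u :+ con 0) :+ (con 1 :+ x) :* d) refl (∑ₛ λ r → cov r p * cov r q) (δ p q) (ι n) ⟩
    (∑ₛ (λ r → cov r p * cov r q) + 0#) + (1# + ι n) * δ p q
      ≈⟨ +-congʳ (trans (∑ₛ-∷ _) (+-congˡ (∑ₛ-0 λ _ → zeroˡ _))) ⟨
    ∑ₛ (λ r → cov r (false ∷ p) * cov r (false ∷ q)) + (1# + ι n) * δ p q ∎
    where x = ι ∣ p ∣ + ι ∣ p ∣
  -- Both sums collapse to the single value `cov q p`.
  up-down (false ∷ p) (true ∷ q) = +-cong
    (trans (trans (∑ₛ-∷ _) (trans (+-cong (∑ₛ-0 λ _ → zeroʳ _) (∑ₛ-selectˡ p (cov q))) (+-identityˡ _)))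
      (sym (trans (∑ₛ-∷ _) (trans (+-cong (trans (∑ₛ-cong λ _ → *-comm _ _) (∑ₛ-selectʳ q (λ r → cov r p))) (∑ₛ-0 λ _ → zeroˡ _)) (+-identityʳ _)))))
    (trans (zeroʳ _) (sym (zeroʳ _)))
  up-down (true ∷ p) (false ∷ q) = +-cong
    (trans (trans (∑ₛ-∷ _) (trans (+-cong (∑ₛ-0 λ _ → zeroˡ _) (trans (∑ₛ-cong λ _ → *-comm _ _) (∑ₛ-selectˡ q (cov p)))) (+-identityˡ _)))
      (sym (trans (∑ₛ-∷ _) (trans (+-cong (∑ₛ-selectʳ p (λ r → cov r q)) (∑ₛ-0 λ _ → zeroʳ _)) (+-identityʳ _)))))
    (trans (zeroʳ _) (sym (zeroʳ _)))
  up-down {suc n} (true ∷ p) (true ∷ q) = begin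
    ∑ₛ (λ r → cov (true ∷ p) r * cov (true ∷ q) r) + ((1# + ι ∣ p ∣) + (1# + ι ∣ p ∣)) * δ p q
      ≈⟨ +-congʳ (trans (∑ₛ-∷ _) (+-congʳ (∑ₛ-0 λ _ → zeroˡ _))) ⟩
    (0# + ∑ₛ (λ r → cov p r * cov q r)) + ((1# + ι ∣ p ∣) + (1# + ι ∣ p ∣)) * δ p q
      ≈⟨ solve 3 (λ u d x → (con 0 :+ u) :+ ((con 1 :+ x) :+ (con 1 :+ x)) :* d := (u :+ (x :+ x) :* d) :+ (d :+ d)) refl
           (∑ₛ λ r → cov p r * cov q r) (δ p q) (ι ∣ p ∣) ⟩
    (∑ₛ (λ r → cov p r * cov q r) + (ι ∣ p ∣ + ι ∣ p ∣) * δ p q) + (δ p q + δ p q)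
      ≈⟨ +-congʳ (up-down p q) ⟩
    (∑ₛ (λ r → cov r p * cov r q) + ι n * δ p q) + (δ p q + δ p q)
      ≈⟨ solve 3 (λ u d x → (u :+ x :* d) :+ (d :+ d) := (d :+ u) :+ (con 1 :+ x) :* d) refl
           (∑ₛ λ r → cov r p * cov r q) (δ p q) (ι n) ⟩
    (δ p q + ∑ₛ (λ r → cov r p * cov r q)) + (1# + ι n) * δ p q
      ≈⟨ +-congʳ (trans (∑ₛ-∷ _) (+-congʳ (∑ₛ-selectʳ p (λ r → δ r q)))) ⟨
    ∑ₛ (λ r → cov r (true ∷ p) * cov r (true ∷ q)) + (1# + ι n) * δ p q ∎

  -- The inclusion matrix of the j-subsets in the (j + 1)-subsets.
  W : ∀ n j → Fin (length (level n j)) → Fin (length (level n (suc j))) → Carrier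
  W n j a b = cov (lookup (level n j) a) (lookup (level n (suc j)) b)

  gram : ∀ n → ℕ → Carrier → Carrier
  gram n j z = det λ (a b : Fin (length (level n j))) → z * 𝟏 a b - ∑ λ l → W n j a l * W n j b l

  δ-lookup : ∀ n j (a b : Fin (length (level n j))) → δ (lookup (level n j) a) (lookup (level n j) b) ≈ 𝟏 a b
  δ-lookup n j a b = ⟦⟧-cong (lookup (level n j) a ≟ₛ lookup (level n j) b) (a Fin.≟ b)
    (lookup-injective (level! n j)) (≡.cong (lookup (level n j)))

  -- Turns a relation of the shape of `up-down` into a shift of the variable by the scalar `c - t`.
  [z-c]x-y : ∀ {z c x y s t} → s + t * x ≈ y + c * x → z * x - s ≈ (z - (c - t)) * x - y
  [z-c]x-y {z} {c} {x} {y} {s} {t} eq = begin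
    z * x - s                          ≈⟨ +-congˡ (-‿cong s≈) ⟩
    z * x - (y + (c - t) * x)          ≈⟨ +-congˡ (-‿+-comm _ _) ⟨
    z * x + (- y - (c - t) * x)        ≈⟨ trans (+-congˡ (+-comm _ _)) (sym (+-assoc _ _ _)) ⟩
    (z * x - (c - t) * x) - y          ≈⟨ +-congʳ ([y-z]x≈yx-zx x z (c - t)) ⟨
    (z - (c - t)) * x - y              ∎
    where
    s≈ : s ≈ y + (c - t) * x
    s≈ = begin
      s                            ≈⟨ trans (+-congˡ (-‿inverseʳ (t * x))) (+-identityʳ s) ⟨
      s + (t * x - t * x)          ≈⟨ +-assoc _ _ _ ⟨
      (s + t * x) - t * x          ≈⟨ +-congʳ eq ⟩
      (y + c * x) - t * x          ≈⟨ +-assoc _ _ _ ⟩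
      y + (c * x - t * x)          ≈⟨ +-congˡ ([y-z]x≈yx-zx x c t) ⟨
      y + (c - t) * x              ∎

  ∑-W² : ∀ n j (a b : Fin (length (level n j))) →
    ∑ (λ l → W n j a l * W n j b l) ≈ ∑ₛ (λ r → cov (lookup (level n j) a) r * cov (lookup (level n j) b) r)
  ∑-W² n j a b = ∑-level (suc j) (λ r → cov (lookup (level n j) a) r * cov (lookup (level n j) b) r) λ r ∣r∣≢ →
    trans (*-congʳ (cov-graded (lookup (level n j) a) r λ eq → ∣r∣≢ (≡.trans (≡.sym eq) (≡.cong suc (size n j a))))) (zeroˡ _)

  -- By `up-down` at sets of size j + 1, the matrix at level j + 1 is W_jᵀ W_j plus the scalar `c`.
  -- The exponents are the sizes of the two levels between which Sylvester's identity passes.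
  gram-suc : ∀ n j z → let c = ι n - (ι (suc j) + ι (suc j)) in
    (z - c) ^ length (level n j) * gram n (suc j) z ≈ (z - c) ^ length (level n (suc j)) * gram n j (z - c)
  gram-suc n j z = trans (*-congˡ (det-cong entry))
    (sylvester (z - c) (λ a l → W n j l a) (W n j))
    where
    c = ι n - (ι (suc j) + ι (suc j))
    entry : ∀ a b → z * 𝟏 a b - ∑ (λ l → W n (suc j) a l * W n (suc j) b l)
      ≈ (z - c) * 𝟏 a b - ∑ (λ l → W n j l a * W n j l b)
    entry a b = [z-c]x-y (begin
      ∑ (λ l → W n (suc j) a l * W n (suc j) b l) + (ι (suc j) + ι (suc j)) * 𝟏 a b
        ≈⟨ +-cong (∑-W² n (suc j) a b) (*-cong (reflexive (≡.cong (λ s → ι s + ι s) (≡.sym (size n (suc j) a)))) (sym (δ-lookup n (suc j) a b))) ⟩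
      ∑ₛ (λ r → cov p r * cov q r) + (ι ∣ p ∣ + ι ∣ p ∣) * δ p q
        ≈⟨ up-down p q ⟩
      ∑ₛ (λ r → cov r p * cov r q) + ι n * δ p q
        ≈⟨ +-cong (sym (∑-level j (λ r → cov r p * cov r q) λ r ∣r∣≢ → trans
             (*-congʳ (cov-graded r p λ eq → ∣r∣≢ (ℕ.suc-injective (≡.trans eq (size n (suc j) a))))) (zeroˡ _)))
             (*-congˡ (δ-lookup n (suc j) a b)) ⟩
      ∑ (λ l → W n j l a * W n j l b) + ι n * 𝟏 a b ∎)
      where
      p = lookup (level n (suc j)) a
      q = lookup (level n (suc j)) b

  -- Nothing lies below the empty set, so the down sum in `up-down` vanishes and a scalar matrix
  -- remains.
  gram-zero : ∀ n z → gram n 0 z ≈ (z - ι n) ^ length (level n 0)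
  gram-zero n z = trans (det-cong entry) (det-scalar _ (z - ι n))
    where
    entry : ∀ a b → z * 𝟏 a b - ∑ (λ l → W n 0 a l * W n 0 b l) ≈ (z - ι n) * 𝟏 a b
    entry a b = trans
      ([z-c]x-y {c = ι n} {y = 0#} {t = 0#} (begin
        ∑ (λ l → W n 0 a l * W n 0 b l) + 0# * 𝟏 a b
          ≈⟨ +-cong (∑-W² n 0 a b) (*-cong (trans (sym (+-identityˡ 0#)) (reflexive (≡.cong (λ s → ι s + ι s) (≡.sym (size n 0 a))))) (sym (δ-lookup n 0 a b))) ⟩
        ∑ₛ (λ r → cov p r * cov q r) + (ι ∣ p ∣ + ι ∣ p ∣) * δ p q
          ≈⟨ up-down p q ⟩
        ∑ₛ (λ r → cov r p * cov r q) + ι n * δ p q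
          ≈⟨ +-cong (∑ₛ-0 λ r → trans (*-congʳ (cov-graded r p λ eq → ℕ.1+n≢0 (≡.trans eq (size n 0 a)))) (zeroˡ _))
               (*-congˡ (δ-lookup n 0 a b)) ⟩
        0# + ι n * 𝟏 a b ∎))
      (trans (+-congˡ -0#≈0#) (trans (+-identityʳ _)
        (*-congʳ (+-congˡ (-‿cong (trans (+-congˡ -0#≈0#) (+-identityʳ _)))))))
      where
      p = lookup (level n 0) a
      q = lookup (level n 0) b

-- Two consecutive layers

module Layers (R : CommutativeRing 0ℓ 0ℓ) (n j : ℕ) where
  open CommutativeRing R hiding (zero)
  open Algebra.Properties.Ring ring using (-‿distribˡ-*; -‿distribʳ-*; [y-z]x≈yx-zx)
  open Algebra.Properties.Group +-group using (⁻¹-involutive)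
  open Algebra.Properties.Semiring.Exp semiring using (_^_)
  open Sums R
  open ListSums R
  open Determinants R
  open BlockDeterminants R
  open BooleanLattice R
  open import Relation.Binary.Reasoning.Setoid setoid

  Γ : Graph
  Γ = BLlayers n (suc j)

  open Graph Γ using (vertices; unique; adj?)
  open LineGraphs R Γ using (degree; lineGraph-det; handshake)
  private
    module L = Graph (lineGraph Γ)
    lower upper : ℕ
    lower = length (level n j)
    upper = length (level n (suc j))

    low : Fin lower → Subset n
    low = lookup (level n j)

    up : Fin upper → Subset n
    up = lookup (level n (suc j))

    -- The list `vertices` mixes the two layers. Listing the lower one first makes the matrix a
    -- block matrix, and since `lineGraph-det` accepts any such enumeration, no permutation of a
    -- determinant is required.
    vs : Fin (lower ℕ.+ upper) → Subset n
    vs = stack low up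

    inLayers? : (p : Subset n) → Dec (suc ∣ p ∣ ≡ suc j ⊎ ∣ p ∣ ≡ suc j)
    inLayers? p = (suc ∣ p ∣ ℕ.≟ suc j) ⊎-dec (∣ p ∣ ℕ.≟ suc j)

  ∑-vertices : (f : Subset n → Carrier) → ∑ₗ vertices f ≈ ∑ₗ (level n j) f + ∑ₗ (level n (suc j)) f
  ∑-vertices f = begin
    ∑ₗ vertices f
      ≈⟨ ∑ₗ-filter inLayers? (subsets n) f ⟩
    ∑ₗ (subsets n) (λ p → ⟦ inLayers? p ⟧ * f p)
      ≈⟨ ∑-cong (λ i → trans (*-congʳ (split (suc ∣ lookup (subsets n) i ∣ ℕ.≟ suc j) (∣ lookup (subsets n) i ∣ ℕ.≟ suc j)))
           (distribʳ _ _ _)) ⟩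
    ∑ₗ (subsets n) (λ p → ⟦ ∣ p ∣ ℕ.≟ j ⟧ * f p + ⟦ ∣ p ∣ ℕ.≟ suc j ⟧ * f p)
      ≈⟨ ∑-+ _ _ ⟩
    ∑ₗ (subsets n) (λ p → ⟦ ∣ p ∣ ℕ.≟ j ⟧ * f p) + ∑ₗ (subsets n) (λ p → ⟦ ∣ p ∣ ℕ.≟ suc j ⟧ * f p)
      ≈⟨ +-cong (∑ₗ-filter (λ p → ∣ p ∣ ℕ.≟ j) (subsets n) f) (∑ₗ-filter (λ p → ∣ p ∣ ℕ.≟ suc j) (subsets n) f) ⟨
    ∑ₗ (level n j) f + ∑ₗ (level n (suc j)) f ∎
    where
    split : ∀ {s} (d : Dec (suc s ≡ suc j)) (e : Dec (s ≡ suc j)) → ⟦ d ⊎-dec e ⟧ ≈ ⟦ d ⟧ + ⟦ e ⟧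
    split (yes ≡.refl) (yes eq) = contradiction (≡.sym eq) ℕ.1+n≢n
    split (yes _) (no _)  = sym (+-identityʳ _)
    split (no _)  (yes _) = sym (+-identityˡ _)
    split (no _)  (no _)  = sym (+-identityˡ _)

  private
    ∑-vs : (f : Subset n → Carrier) → ∑ (λ i → f (vs i)) ≈ ∑ₗ vertices f
    ∑-vs f = trans (∑-splitAt {lower} (λ i → f (vs i))) (trans
      (+-cong (∑-cong λ a → reflexive (≡.cong (f ∘ Sum.[ low , up ]) (Fin.splitAt-↑ˡ lower a upper)))
              (∑-cong λ b → reflexive (≡.cong (f ∘ Sum.[ low , up ]) (Fin.splitAt-↑ʳ lower upper b))))
      (sym (∑-vertices f)))

    vs∈ : ∀ i → vs i ∈ vertices
    vs∈ i with splitAt lower i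
    ... | inj₁ a = ∈-filter⁺ inLayers? (subsets-complete (low a)) (inj₁ (≡.cong suc (size n j a)))
    ... | inj₂ b = ∈-filter⁺ inLayers? (subsets-complete (up b)) (inj₂ (size n (suc j) b))

    vs-select : ∀ {p} → p ∈ vertices → (g : Subset n → Carrier) → ∑ (λ i → ⟦ vs i ≟ₛ p ⟧ * g (vs i)) ≈ g p
    vs-select {p} p∈ g = trans (∑-vs λ q → ⟦ q ≟ₛ p ⟧ * g q)
      (trans (∑-cong λ i → *-congʳ (δ-sym _ p)) (∑ₗ-select _≟ₛ_ unique p∈ g))

    2+n≢n : ∀ {n} → suc (suc n) ≢ n
    2+n≢n eq = ℕ.<⇒≢ (ℕ.m<n⇒m<1+n (ℕ.n<1+n _)) (≡.sym eq)

    adj-level : ∀ {i} p q → ∣ p ∣ ≡ i → ∣ q ∣ ≡ i → ⟦ adj? p q ⟧ ≈ 0#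
    adj-level p q ∣p∣≡ ∣q∣≡ = trans (adj-cov p q) (trans
      (+-cong (cov-graded p q λ eq → ℕ.1+n≢n (≡.trans eq (≡.trans ∣q∣≡ (≡.sym ∣p∣≡))))
              (cov-graded q p λ eq → ℕ.1+n≢n (≡.trans eq (≡.trans ∣p∣≡ (≡.sym ∣q∣≡)))))
      (+-identityˡ _))

    adj-low-up : ∀ p q → ∣ p ∣ ≡ j → ∣ q ∣ ≡ suc j → ⟦ adj? p q ⟧ ≈ cov p q
    adj-low-up p q ∣p∣≡ ∣q∣≡ = trans (adj-cov p q) (trans
      (+-congˡ (cov-graded q p λ eq → 2+n≢n (≡.trans (≡.cong suc (≡.sym ∣q∣≡)) (≡.trans eq ∣p∣≡))))
      (+-identityʳ _))

    adj-up-low : ∀ q p → ∣ q ∣ ≡ suc j → ∣ p ∣ ≡ j → ⟦ adj? q p ⟧ ≈ cov p q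
    adj-up-low q p ∣q∣≡ ∣p∣≡ = trans (adj-cov q p) (trans (+-comm _ _) (trans (sym (adj-cov p q)) (adj-low-up p q ∣p∣≡ ∣q∣≡)))

  degree-low : ∀ p → ∣ p ∣ ≡ j → degree p ≈ ι n - ι j
  degree-low p ∣p∣≡j = begin
    degree p
      ≈⟨ ∑-vertices (λ q → ⟦ adj? p q ⟧) ⟩
    ∑ₗ (level n j) (λ q → ⟦ adj? p q ⟧) + ∑ₗ (level n (suc j)) (λ q → ⟦ adj? p q ⟧)
      ≈⟨ +-cong (∑-0 λ a → adj-level p (low a) ∣p∣≡j (size n j a))
                (∑-cong λ b → adj-low-up p (up b) ∣p∣≡j (size n (suc j) b)) ⟩
    0# + ∑ₗ (level n (suc j)) (cov p)
      ≈⟨ trans (+-identityˡ _) (∑-level (suc j) (cov p) λ r ∣r∣≢ → cov-graded p r λ eq →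
           ∣r∣≢ (≡.trans (≡.sym eq) (≡.cong suc ∣p∣≡j))) ⟩
    ∑ₛ (cov p)
      ≈⟨ trans (+-congˡ (-‿inverseʳ (ι j))) (+-identityʳ _) ⟨
    ∑ₛ (cov p) + (ι j - ι j)
      ≈⟨ +-assoc _ _ _ ⟨
    (∑ₛ (cov p) + ι j) - ι j
      ≈⟨ +-congʳ (trans (+-congˡ (reflexive (≡.cong ι (≡.sym ∣p∣≡j)))) (up-degree p)) ⟩
    ι n - ι j ∎

  degree-up : ∀ q → ∣ q ∣ ≡ suc j → degree q ≈ ι (suc j)
  degree-up q ∣q∣≡ = begin
    degree q
      ≈⟨ ∑-vertices (λ p → ⟦ adj? q p ⟧) ⟩
    ∑ₗ (level n j) (λ p → ⟦ adj? q p ⟧) + ∑ₗ (level n (suc j)) (λ p → ⟦ adj? q p ⟧)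
      ≈⟨ +-cong (∑-cong λ a → adj-up-low q (low a) ∣q∣≡ (size n j a))
                (∑-0 λ b → adj-level q (up b) ∣q∣≡ (size n (suc j) b)) ⟩
    ∑ₗ (level n j) (flip cov q) + 0#
      ≈⟨ trans (+-identityʳ _) (∑-level j (flip cov q) λ r ∣r∣≢ → cov-graded r q λ eq →
           ∣r∣≢ (ℕ.suc-injective (≡.trans eq ∣q∣≡))) ⟩
    ∑ₛ (flip cov q)
      ≈⟨ down-degree q ⟩
    ι ∣ q ∣
      ≡⟨ ≡.cong ι ∣q∣≡ ⟩
    ι (suc j) ∎

  edge-count : ι (length (edges Γ)) * (1# + 1#)
    ≈ ι lower * (ι n - ι j) + ι upper * ι (suc j)
  edge-count = begin
    ι (length (edges Γ)) * (1# + 1#)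
      ≈⟨ ∑ₗ-const (edges Γ) (1# + 1#) ⟨
    ∑ₗ (edges Γ) (λ _ → 1# + 1#)
      ≈⟨ handshake ⟩
    ∑ₗ vertices degree
      ≈⟨ ∑-vertices degree ⟩
    ∑ₗ (level n j) degree + ∑ₗ (level n (suc j)) degree
      ≈⟨ +-cong (∑-cong λ a → degree-low (low a) (size n j a)) (∑-cong λ b → degree-up (up b) (size n (suc j) b)) ⟩
    ∑ₗ (level n j) (λ _ → ι n - ι j) + ∑ₗ (level n (suc j)) (λ _ → ι (suc j))
      ≈⟨ +-cong (∑ₗ-const (level n j) (ι n - ι j)) (∑ₗ-const (level n (suc j)) (ι (suc j))) ⟩
    ι lower * (ι n - ι j) + ι upper * ι (suc j) ∎

  layerBlocks : Carrier → Matrix Carrier (lower ℕ.+ upper)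
  layerBlocks y = block
    (λ a b → (y - (ι n - ι j)) * 𝟏 a b) (λ a b → - W n j a b)
    (λ b a → - W n j a b)               (λ a b → (y - ι (suc j)) * 𝟏 a b)

  -- Degrees are constant on each layer, namely n - j and j + 1, and no edge runs within a layer;
  -- hence the scalar diagonal blocks.
  layers-blocks : ∀ y →
    det (λ i j → y * 𝟏 i j - (⟦ vs j ≟ₛ vs i ⟧ * degree (vs i) + ⟦ adj? (vs i) (vs j) ⟧))
    ≈ det (layerBlocks y)
  layers-blocks y = det-cong entry
    where
    y𝟏-t : ∀ {x e d a t} → e ≈ x → d ≈ t → a ≈ 0# → y * x - (e * d + a) ≈ (y - t) * x
    y𝟏-t {x} {t = t} e≈ d≈ a≈ = trans
      (+-congˡ (-‿cong (trans (+-cong (trans (*-cong e≈ d≈) (*-comm _ _)) a≈) (+-identityʳ _))))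
      (sym ([y-z]x≈yx-zx x y t))
    y0-c : ∀ {x e d a c} → x ≈ 0# → e ≈ 0# → a ≈ c → y * x - (e * d + a) ≈ - c
    y0-c x≈ e≈ a≈ = trans
      (+-cong (trans (*-congˡ x≈) (zeroʳ y)) (-‿cong (trans (+-cong (trans (*-congʳ e≈) (zeroˡ _)) a≈) (+-identityˡ _))))
      (+-identityˡ _)
    distinct : ∀ {p q : Subset n} → ∣ p ∣ ≡ j → ∣ q ∣ ≡ suc j → p ≢ q
    distinct ∣p∣≡ ∣q∣≡ ≡.refl = ℕ.1+n≢n (≡.trans (≡.sym ∣q∣≡) ∣p∣≡)
    entry : ∀ i i′ → y * 𝟏 i i′ - (⟦ vs i′ ≟ₛ vs i ⟧ * degree (vs i) + ⟦ adj? (vs i) (vs i′) ⟧)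
      ≈ layerBlocks y i i′
    entry i i′ = trans (+-congʳ (*-congˡ (reflexive (𝟏-block lower i i′)))) (cases i i′)
      where
      cases : ∀ i i′ → y * block {m = lower} 𝟏 (λ _ _ → 0#) (λ _ _ → 0#) 𝟏 i i′
          - (⟦ vs i′ ≟ₛ vs i ⟧ * degree (vs i) + ⟦ adj? (vs i) (vs i′) ⟧)
        ≈ layerBlocks y i i′
      cases i i′ with splitAt lower i
      cases i i′ | inj₁ a with splitAt lower i′
      ... | inj₁ b = y𝟏-t (trans (δ-sym (low b) (low a)) (δ-lookup n j a b))
              (degree-low (low a) (size n j a)) (adj-level (low a) (low b) (size n j a) (size n j b))
      ... | inj₂ b = y0-c refl (⟦⟧-false (up b ≟ₛ low a) (distinct (size n j a) (size n (suc j) b) ∘ ≡.sym))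
              (adj-low-up (low a) (up b) (size n j a) (size n (suc j) b))
      cases i i′ | inj₂ a with splitAt lower i′
      ... | inj₁ b = y0-c refl (⟦⟧-false (low b ≟ₛ up a) (distinct (size n j b) (size n (suc j) a)))
              (adj-up-low (up a) (low b) (size n (suc j) a) (size n j b))
      ... | inj₂ b = y𝟏-t (trans (δ-sym (up b) (up a)) (δ-lookup n (suc j) a b))
              (degree-up (up a) (size n (suc j) a)) (adj-level (up a) (up b) (size n (suc j) a) (size n (suc j) b))

  -- Eliminating the upper layer, whose block is the scalar `x`, leaves W Wᵀ subtracted from the
  -- product of the two diagonal scalars. That product is the argument of `gram`; the two signs of
  -- the off-diagonal blocks cancel.
  lineGraph-gram : ∀ y → let x = y - ι (suc j) in
    y ^ (lower ℕ.+ upper) *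
      (x ^ lower * det (λ i j → y * 𝟏 i j -
        (⟦ L.adj? (lookup (edges Γ) i) (lookup (edges Γ) j) ⟧ + (1# + 1#) * 𝟏 i j)))
    ≈ y ^ length (edges Γ) * (x ^ upper * gram n j (x * (y - (ι n - ι j))))
  lineGraph-gram y = begin
    y ^ (lower ℕ.+ upper) * (x ^ lower * D)
      ≈⟨ exchange _ _ _ ⟩
    x ^ lower * (y ^ (lower ℕ.+ upper) * D)
      ≈⟨ *-congˡ (trans (lineGraph-det y vs vs∈ vs-select) (*-congˡ (layers-blocks y))) ⟩
    x ^ lower * (y ^ length (edges Γ) * det (layerBlocks y))
      ≈⟨ exchange _ _ _ ⟩
    y ^ length (edges Γ) * (x ^ lower * det (layerBlocks y))
      ≈⟨ *-congˡ (det-scalarBlock x (λ a b → (y - (ι n - ι j)) * 𝟏 a b) (λ a b → - W n j a b) (λ b a → - W n j a b)) ⟩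
    y ^ length (edges Γ) * (x ^ upper * det (λ a b → x * ((y - (ι n - ι j)) * 𝟏 a b) - ∑ λ l → - W n j a l * - W n j b l))
      ≈⟨ *-congˡ (*-congˡ (det-cong λ a b → +-cong (sym (*-assoc _ _ _)) (-‿cong (∑-cong λ l →
           trans (sym (-‿distribˡ-* _ _)) (trans (-‿cong (sym (-‿distribʳ-* _ _))) (⁻¹-involutive _)))))) ⟩
    y ^ length (edges Γ) * (x ^ upper * gram n j (x * (y - (ι n - ι j)))) ∎
    where
    x = y - ι (suc j)
    D = det (λ i j → y * 𝟏 i j -
        (⟦ L.adj? (lookup (edges Γ) i) (lookup (edges Γ) j) ⟧ + (1# + 1#) * 𝟏 i j))
    exchange : ∀ a b c → a * (b * c) ≈ b * (a * c)
    exchange a b c = trans (sym (*-assoc a b c)) (trans (*-congʳ (*-comm a b)) (*-assoc b a c))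

-- Binomial coefficients

open import Data.Nat.Combinatorics
  using (_C_; nCn≡1; nCk≡nC[n∸k]; nCk+nC[k+1]≡[n+1]C[k+1]; k>n⇒nCk≡0)
open ≡ using (refl; sym; trans; cong; cong₂; subst; module ≡-Reasoning)

nC0≡1 : ∀ n → n C 0 ≡ 1
nC0≡1 n = trans (nCk≡nC[n∸k] {0} {n} ℕ.z≤n) (nCn≡1 n)

length-filter-map : ∀ {A B : Set} {P : Pred A 0ℓ} {Q : Pred B 0ℓ} (P? : Decidable P) (Q? : Decidable Q) (f : A → B) →
  (∀ x → does (Q? (f x)) ≡ does (P? x)) → ∀ xs → length (filter Q? (map f xs)) ≡ length (filter P? xs)
length-filter-map P? Q? f eq []       = refl
length-filter-map P? Q? f eq (x ∷ xs) with does (Q? (f x)) | does (P? x) | eq x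
... | true  | _ | refl = cong suc (length-filter-map P? Q? f eq xs)
... | false | _ | refl = length-filter-map P? Q? f eq xs

length-filter-false : ∀ {A : Set} {P : Pred A 0ℓ} (P? : Decidable P) → (∀ x → does (P? x) ≡ false) →
  ∀ xs → length (filter P? xs) ≡ 0
length-filter-false P? eq []       = refl
length-filter-false P? eq (x ∷ xs) with does (P? x) | eq x
... | _ | refl = length-filter-false P? eq xs

length-level : ∀ n j → length (level n j) ≡ n C j
length-level zero    zero    = refl
length-level zero    (suc j) = sym (k>n⇒nCk≡0 {0} {suc j} (ℕ.s≤s ℕ.z≤n))
length-level (suc n) j = trans
  (trans (cong length (filter-++ P? (map (false ∷_) (subsets n)) _)) (length-++ (filter P? (map (false ∷_) (subsets n)))))
  (trans (cong₂ ℕ._+_ (trans (length-filter-map (λ p → ∣ p ∣ ℕ.≟ j) P? (false ∷_) (λ _ → refl) (subsets n)) (length-level n j)) (upper j)) (pascal j))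
  where
  P? : Decidable (λ (p : Subset (suc n)) → ∣ p ∣ ≡ j)
  P? p = ∣ p ∣ ℕ.≟ j
  -- This is C(n, j - 1), with the value 0 at j = 0 that truncated subtraction would miss.
  below : ℕ → ℕ
  below zero    = 0
  below (suc j) = n C j
  upper : ∀ j → length (filter (λ p → ∣ p ∣ ℕ.≟ j) (map (true ∷_) (subsets n))) ≡ below j
  upper zero    = trans (length-filter-map (λ p → suc ∣ p ∣ ℕ.≟ 0) (λ p → ∣ p ∣ ℕ.≟ 0) (true ∷_) (λ _ → refl) (subsets n))
                        (length-filter-false (λ p → suc ∣ p ∣ ℕ.≟ 0) (λ _ → refl) (subsets n))
  upper (suc j) = trans (length-filter-map (λ p → ∣ p ∣ ℕ.≟ j) (λ p → ∣ p ∣ ℕ.≟ suc j) (true ∷_) (λ _ → refl) (subsets n))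
                        (length-level n j)
  pascal : ∀ j → n C j ℕ.+ below j ≡ suc n C j
  pascal zero    = trans (ℕ.+-identityʳ _) (trans (nC0≡1 n) (sym (nC0≡1 (suc n))))
  pascal (suc j) = trans (ℕ.+-comm (n C suc j) (n C j)) (nCk+nC[k+1]≡[n+1]C[k+1] n j)

-- (j + 1) C(n,j+1) = (n - j) C(n,j) with j C(n,j) moved to the left, so that no
-- subtraction occurs.
absorption : ∀ n j → suc j ℕ.* (n C suc j) ℕ.+ j ℕ.* (n C j) ≡ n ℕ.* (n C j)
absorption zero zero    = refl
absorption zero (suc j) = trans (cong₂ (λ s t → suc (suc j) ℕ.* s ℕ.+ suc j ℕ.* t)
  (k>n⇒nCk≡0 {0} {suc (suc j)} (ℕ.s≤s ℕ.z≤n)) (k>n⇒nCk≡0 {0} {suc j} (ℕ.s≤s ℕ.z≤n))) (arith (suc (suc j)) (suc j))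
  where
  arith : ∀ a b → a ℕ.* 0 ℕ.+ b ℕ.* 0 ≡ 0
  arith = ℕ.solve-∀
absorption (suc n) zero = begin
  1 ℕ.* (suc n C 1) ℕ.+ 0         ≡⟨ cong (λ t → 1 ℕ.* t ℕ.+ 0) (sym (nCk+nC[k+1]≡[n+1]C[k+1] n 0)) ⟩
  1 ℕ.* (n C 0 ℕ.+ n C 1) ℕ.+ 0 ≡⟨ arith (n C 0) (n C 1) ⟩
  n C 0 ℕ.+ (1 ℕ.* (n C 1) ℕ.+ 0) ≡⟨ cong₂ ℕ._+_ (nC0≡1 n) (absorption n 0) ⟩
  1 ℕ.+ n ℕ.* (n C 0)             ≡⟨ cong (λ t → 1 ℕ.+ n ℕ.* t) (nC0≡1 n) ⟩
  suc n ℕ.* 1                   ≡⟨ cong (suc n ℕ.*_) (nC0≡1 (suc n)) ⟨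
  suc n ℕ.* (suc n C 0)           ∎
  where
  open ≡-Reasoning
  arith : ∀ a b → 1 ℕ.* (a ℕ.+ b) ℕ.+ 0 ≡ a ℕ.+ (1 ℕ.* b ℕ.+ 0)
  arith = ℕ.solve-∀
absorption (suc n) (suc j) = begin
  suc (suc j) ℕ.* (suc n C suc (suc j)) ℕ.+ suc j ℕ.* (suc n C suc j)
    ≡⟨ cong₂ (λ s t → suc (suc j) ℕ.* s ℕ.+ suc j ℕ.* t)
         (nCk+nC[k+1]≡[n+1]C[k+1] n (suc j)) (nCk+nC[k+1]≡[n+1]C[k+1] n j) ⟨
  suc (suc j) ℕ.* (b ℕ.+ c) ℕ.+ suc j ℕ.* (a ℕ.+ b)
    ≡⟨ arith₁ j a b c ⟩
  (suc (suc j) ℕ.* c ℕ.+ suc j ℕ.* b) ℕ.+ (suc j ℕ.* b ℕ.+ j ℕ.* a) ℕ.+ (a ℕ.+ b)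
    ≡⟨ cong₂ (λ s t → s ℕ.+ t ℕ.+ (a ℕ.+ b)) (absorption n (suc j)) (absorption n j) ⟩
  n ℕ.* b ℕ.+ n ℕ.* a ℕ.+ (a ℕ.+ b)
    ≡⟨ arith₂ n a b ⟩
  suc n ℕ.* (a ℕ.+ b)
    ≡⟨ cong (suc n ℕ.*_) (nCk+nC[k+1]≡[n+1]C[k+1] n j) ⟩
  suc n ℕ.* (suc n C suc j) ∎
  where
  open ≡-Reasoning
  a = n C j
  b = n C suc j
  c = n C suc (suc j)
  arith₁ : ∀ j a b c → suc (suc j) ℕ.* (b ℕ.+ c) ℕ.+ suc j ℕ.* (a ℕ.+ b)
    ≡ (suc (suc j) ℕ.* c ℕ.+ suc j ℕ.* b) ℕ.+ (suc j ℕ.* b ℕ.+ j ℕ.* a) ℕ.+ (a ℕ.+ b)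
  arith₁ = ℕ.solve-∀
  arith₂ : ∀ n a b → n ℕ.* b ℕ.+ n ℕ.* a ℕ.+ (a ℕ.+ b) ≡ suc n ℕ.* (a ℕ.+ b)
  arith₂ = ℕ.solve-∀

-- If C(n,j+1) ≤ C(n,j), the left side of `absorption` would be at most (2j + 1) C(n,j), which is
-- less than (2j + 2) C(n,j) ≤ n C(n,j). Strictness needs C(n,j) > 0, hence the mutual recursion
-- with `C-positive`.
C-increasing : ∀ n j → 2 ℕ.* suc j ≤ n → n C j < n C suc j
C-positive : ∀ n j → 2 ℕ.* j ≤ n → 0 < n C j

C-positive n zero    _    = ℕ.≤-reflexive (sym (nC0≡1 n))
C-positive n (suc j) 2j≤n = ℕ.≤-<-trans ℕ.z≤n (C-increasing n j 2j≤n)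

C-increasing n j 2+2j≤n = ℕ.≰⇒> λ b≤a → ℕ.<-irrefl (absorption n j) (begin-strict
  suc j ℕ.* b ℕ.+ j ℕ.* a   ≤⟨ ℕ.+-monoˡ-≤ (j ℕ.* a) (ℕ.*-monoʳ-≤ (suc j) b≤a) ⟩
  suc j ℕ.* a ℕ.+ j ℕ.* a   <⟨ ℕ.m<n+m _ (C-positive n j (ℕ.≤-trans (ℕ.*-monoʳ-≤ 2 (ℕ.n≤1+n j)) 2+2j≤n)) ⟩
  a ℕ.+ (suc j ℕ.* a ℕ.+ j ℕ.* a)   ≡⟨ arith j a ⟩
  2 ℕ.* suc j ℕ.* a         ≤⟨ ℕ.*-monoˡ-≤ a 2+2j≤n ⟩
  n ℕ.* a                   ∎)
  where
  open ℕ.≤-Reasoning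
  a = n C j
  b = n C suc j
  arith : ∀ j a → a ℕ.+ (suc j ℕ.* a ℕ.+ j ℕ.* a) ≡ 2 ℕ.* suc j ℕ.* a
  arith = ℕ.solve-∀

-- C(n,j) - C(n,j-1), where C(n,-1) = 0; the truncated subtraction is harmless for
-- 2j ≤ n.
mult : ℕ → ℕ → ℕ
mult n zero    = 1
mult n (suc j) = n C suc j ∸ n C j

mult-positive : ∀ n j → 2 ℕ.* j ≤ n → 0 < mult n j
mult-positive n zero    _    = ℕ.s≤s ℕ.z≤n
mult-positive n (suc j) 2j≤n = ℕ.m<n⇒0<n∸m (C-increasing n j 2j≤n)

C+mult : ∀ n j → 2 ℕ.* suc j ≤ n → n C j ℕ.+ mult n (suc j) ≡ n C suc j
C+mult n j 2j≤n = ℕ.m+[n∸m]≡n (ℕ.<⇒≤ (C-increasing n j 2j≤n))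

-- Evaluation of polynomials

open import Data.Integer.Base using (-_; _+_; _-_; _*_)

eval : Poly → ℤ → ℤ
eval []      x = 0ℤ
eval (a ∷ p) x = a + x * eval p x

eval-+ : ∀ p q x → eval (p +ₚ q) x ≡ eval p x + eval q x
eval-+ []      q       x = sym (ℤ.+-identityˡ (eval q x))
eval-+ (a ∷ p) []      x = sym (ℤ.+-identityʳ (eval (a ∷ p) x))
eval-+ (a ∷ p) (b ∷ q) x = trans (cong (λ t → a + b + x * t) (eval-+ p q x)) (arith a b x (eval p x) (eval q x))
  where
  arith : ∀ a b x s t → a + b + x * (s + t) ≡ a + x * s + (b + x * t)
  arith = ℤ.solve-∀

eval-neg : ∀ p x → eval (-ₚ p) x ≡ - eval p x
eval-neg []      x = refl
eval-neg (a ∷ p) x = trans (cong (λ t → - a + x * t) (eval-neg p x)) (arith a x (eval p x))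
  where
  arith : ∀ a x s → - a + x * - s ≡ - (a + x * s)
  arith = ℤ.solve-∀

eval-scale : ∀ a p x → eval (map (a *_) p) x ≡ a * eval p x
eval-scale a []      x = sym (ℤ.*-zeroʳ a)
eval-scale a (b ∷ p) x = trans (cong (λ t → a * b + x * t) (eval-scale a p x)) (arith a b x (eval p x))
  where
  arith : ∀ a b x s → a * b + x * (a * s) ≡ a * (b + x * s)
  arith = ℤ.solve-∀

eval-* : ∀ p q x → eval (p *ₚ q) x ≡ eval p x * eval q x
eval-* []      q x = refl
eval-* (a ∷ p) q x = trans (eval-+ (map (a *_) q) (0ℤ ∷ p *ₚ q) x)
  (trans (cong₂ (λ s t → s + (0ℤ + x * t)) (eval-scale a q x) (eval-* p q x)) (arith a x (eval p x) (eval q x)))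
  where
  arith : ∀ a x s t → a * t + (0ℤ + x * (s * t)) ≡ (a + x * s) * t
  arith = ℤ.solve-∀

eval-const : ∀ a x → eval (constₚ a) x ≡ a
eval-const a x = trans (cong (a +_) (ℤ.*-zeroʳ x)) (ℤ.+-identityʳ a)

eval-X : ∀ x → eval X x ≡ x
eval-X = arith
  where
  arith : ∀ x → 0ℤ + x * (1ℤ + x * 0ℤ) ≡ x
  arith = ℤ.solve-∀

eval-^ : ∀ p n x → eval (p ^ₚ n) x ≡ eval p x ℤ.^ n
eval-^ p zero    x = eval-const 1ℤ x
eval-^ p (suc n) x = trans (eval-* p (p ^ₚ n) x) (cong (eval p x *_) (eval-^ p n x))

private
  module P = Algebra.Definitions.RawSemiring (RawRing.rawSemiring polyRawRing)
  module Z = Algebra.Definitions.RawSemiring (RawRing.rawSemiring ℤ.+-*-rawRing)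

eval-sum : ∀ {n} (f : Fin n → Poly) x → eval (P.sum f) x ≡ Z.sum λ i → eval (f i) x
eval-sum {zero}  f x = refl
eval-sum {suc n} f x = trans (eval-+ (f zero) (P.sum (f ∘ suc)) x)
  (cong (eval (f zero) x +_) (eval-sum (f ∘ suc) x))

eval-sign : ∀ n x → eval ((-ₚ constₚ 1ℤ) ^ₚ n) x ≡ (- 1ℤ) Z.^ n
eval-sign zero    x = eval-const 1ℤ x
eval-sign (suc n) x = trans (eval-* (-ₚ constₚ 1ℤ) ((-ₚ constₚ 1ℤ) ^ₚ n) x)
  (cong₂ _*_ (eval-const (- 1ℤ) x) (eval-sign n x))

eval-det : ∀ {n} (M : Matrix Poly n) x →
  eval (Determinant.det polyRawRing M) x ≡ Determinant.det ℤ.+-*-rawRing λ i j → eval (M i j) x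
eval-det {zero}  M x = eval-const 1ℤ x
eval-det {suc n} M x = trans (eval-sum term x) (sum-cong _ _ λ j → trans
    (eval-* ((-ₚ constₚ 1ℤ) ^ₚ toℕ j) (M zero j *ₚ minor j) x)
    (cong₂ _*_ (eval-sign (toℕ j) x) (trans (eval-* (M zero j) (minor j) x)
      (cong (eval (M zero j) x *_) (eval-det (λ a b → M (suc a) (punchIn j b)) x)))))
  where
  minor : Fin (suc n) → Poly
  minor j = Determinant.det polyRawRing λ a b → M (suc a) (punchIn j b)
  term : Fin (suc n) → Poly
  term j = (-ₚ constₚ 1ℤ) ^ₚ toℕ j *ₚ (M zero j *ₚ minor j)
  sum-cong : ∀ {n} (f g : Fin n → ℤ) → (∀ i → f i ≡ g i) → Z.sum f ≡ Z.sum g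
  sum-cong {zero}  f g eq = refl
  sum-cong {suc n} f g eq = cong₂ _+_ (eq zero) (sum-cong (f ∘ suc) (g ∘ suc) (eq ∘ suc))

eval-charMatrix : ∀ {n} (A : Matrix ℤ n) x i j →
  eval ((if does (i Fin.≟ j) then X else []) +ₚ (-ₚ constₚ (A i j))) x
  ≡ x * (if does (i Fin.≟ j) then 1ℤ else 0ℤ) - A i j
eval-charMatrix A x i j = trans (eval-+ (if does (i Fin.≟ j) then X else []) (-ₚ constₚ (A i j)) x)
  (cong₂ _+_ (diagonal (does (i Fin.≟ j))) (eval-const (- A i j) x))
  where
  diagonal : ∀ b → eval (if b then X else []) x ≡ x * (if b then 1ℤ else 0ℤ)
  diagonal true  = trans (eval-X x) (sym (ℤ.*-identityʳ x))
  diagonal false = sym (ℤ.*-zeroʳ x)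

-- At a root N the constant coefficient `a` is a multiple of N, so a root larger than |a| forces a =
-- 0. The tail then vanishes at all x > c, where x is nonzero and can be cancelled.
zero-polynomial : ∀ p c → (∀ x → c ℕ.≤ x → eval p (ℤ.+ x) ≡ 0ℤ) → ∀ i → coeff p i ≡ 0ℤ
zero-polynomial []      c p≡0 i = refl
zero-polynomial (a ∷ p) c p≡0 = λ where
    zero    → a≡0
    (suc i) → zero-polynomial p (suc c) tail≡0 i
  where
  N = suc (c ℕ.+ ℤ.∣ a ∣)
  e = eval p (ℤ.+ N)
  root : a ≡ - (ℤ.+ N * e)
  root = trans (arith a (ℤ.+ N * e)) (trans (cong (_- ℤ.+ N * e) (p≡0 N (ℕ.m≤n⇒m≤1+n (ℕ.m≤m+n c _)))) (ℤ.+-identityˡ _))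
    where
    arith : ∀ a b → a ≡ a + b - b
    arith = ℤ.solve-∀
  abs : ℤ.∣ a ∣ ≡ N ℕ.* ℤ.∣ e ∣
  abs = trans (cong ℤ.∣_∣ root) (trans (ℤ.∣-i∣≡∣i∣ (ℤ.+ N * e)) (ℤ.abs-* (ℤ.+ N) e))
  small : ∀ m → ℤ.∣ a ∣ ≡ N ℕ.* m → ℤ.∣ a ∣ ≡ 0
  small zero    eq = trans eq (ℕ.*-zeroʳ N)
  small (suc m) eq = contradiction
    (ℕ.≤-trans (ℕ.m≤m*n N (suc m)) (ℕ.≤-reflexive (sym eq)))
    (ℕ.<⇒≱ (ℕ.s≤s (ℕ.m≤n+m ℤ.∣ a ∣ c)))
  a≡0 : a ≡ 0ℤ
  a≡0 = ℤ.∣i∣≡0⇒i≡0 (small ℤ.∣ e ∣ abs)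
  tail≡0 : ∀ x → suc c ℕ.≤ x → eval p (ℤ.+ x) ≡ 0ℤ
  tail≡0 (suc x) c<x with ℤ.i*j≡0⇒i≡0∨j≡0 (ℤ.+ suc x) (trans (sym (ℤ.+-identityˡ _))
    (trans (cong (_+ ℤ.+ suc x * eval p (ℤ.+ suc x)) (sym a≡0)) (p≡0 (suc x) (ℕ.<⇒≤ c<x))))
  ... | inj₂ eq = eq

coeff-+ : ∀ p q i → coeff (p +ₚ q) i ≡ coeff p i + coeff q i
coeff-+ []      q       i       = sym (ℤ.+-identityˡ _)
coeff-+ (a ∷ p) []      i       = sym (ℤ.+-identityʳ _)
coeff-+ (a ∷ p) (b ∷ q) zero    = refl
coeff-+ (a ∷ p) (b ∷ q) (suc i) = coeff-+ p q i

coeff-neg : ∀ p i → coeff (-ₚ p) i ≡ - coeff p i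
coeff-neg []      i       = refl
coeff-neg (a ∷ p) zero    = refl
coeff-neg (a ∷ p) (suc i) = coeff-neg p i

eval-injective : ∀ p q c → (∀ x → c ℕ.≤ x → eval p (ℤ.+ x) ≡ eval q (ℤ.+ x)) → p ≈ₚ q
eval-injective p q c p≗q i = ℤ.i-j≡0⇒i≡j (coeff p i) (coeff q i) (trans
  (sym (trans (coeff-+ p (-ₚ q) i) (cong (_+_ (coeff p i)) (coeff-neg q i))))
  (zero-polynomial (p +ₚ -ₚ q) c (λ x c≤x → trans (eval-+ p (-ₚ q) (ℤ.+ x))
    (trans (cong₂ _+_ (p≗q x c≤x) (eval-neg q (ℤ.+ x))) (ℤ.+-inverseʳ (eval q (ℤ.+ x))))) i))

-- The spectrum

open Determinants ℤ.+-*-commutativeRing using (det; det≡; det-cong)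
open BlockDeterminants ℤ.+-*-commutativeRing using (𝟏)
open BooleanLattice ℤ.+-*-commutativeRing using (ι; gram; gram-suc; gram-zero)
open Algebra.Properties.Semiring.Exp ℤ.+-*-semiring using () renaming (_^_ to _^ᴿ_)

^ᴿ≡^ : ∀ x n → x ^ᴿ n ≡ x ℤ.^ n
^ᴿ≡^ x zero    = refl
^ᴿ≡^ x (suc n) = cong (x *_) (^ᴿ≡^ x n)

ι≡+ : ∀ n → ι n ≡ ℤ.+ n
ι≡+ zero    = refl
ι≡+ (suc n) = cong (_+_ 1ℤ) (ι≡+ n)

*-cancel-≢0 : ∀ i {j k} → i ≢ 0ℤ → i * j ≡ i * k → j ≡ k
*-cancel-≢0 i {j} {k} i≢0 = ℤ.*-cancelˡ-≡ i j k {{ℤ.≢-nonZero i≢0}}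

^-≢0 : ∀ x n → x ≢ 0ℤ → x ℤ.^ n ≢ 0ℤ
^-≢0 x n x≢0 = x≢0 ∘ ℤ.i^n≡0⇒i≡0 x n

*-^ : ∀ x y n → (x * y) ℤ.^ n ≡ x ℤ.^ n * y ℤ.^ n
*-^ x y zero    = refl
*-^ x y (suc n) = trans (cong ((x * y) *_) (*-^ x y n)) (arith x y (x ℤ.^ n) (y ℤ.^ n))
  where
  arith : ∀ a b c d → (a * b) * (c * d) ≡ (a * c) * (b * d)
  arith = ℤ.solve-∀

-- The last factor is split off because each level adds the eigenvalue of largest index.
∏ : ℕ → (ℕ → ℤ) → ℤ
∏ zero    f = 1ℤ
∏ (suc n) f = ∏ n f * f n

∏-cong : ∀ n {f g} → (∀ i → i < n → f i ≡ g i) → ∏ n f ≡ ∏ n g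
∏-cong zero    eq = refl
∏-cong (suc n) eq = cong₂ _*_ (∏-cong n λ i i<n → eq i (ℕ.m<n⇒m<1+n i<n)) (eq n ℕ.≤-refl)

∏-* : ∀ n f g → ∏ n (λ i → f i * g i) ≡ ∏ n f * ∏ n g
∏-* zero    f g = refl
∏-* (suc n) f g = trans (cong (_* (f n * g n)) (∏-* n f g)) (arith (∏ n f) (∏ n g) (f n) (g n))
  where
  arith : ∀ a b c d → (a * b) * (c * d) ≡ (a * c) * (b * d)
  arith = ℤ.solve-∀

∏-head : ∀ n f → ∏ (suc n) f ≡ f 0 * ∏ n (f ∘ suc)
∏-head zero    f = ℤ.*-comm 1ℤ (f 0)
∏-head (suc n) f = trans (cong (_* f (suc n)) (∏-head n f)) (ℤ.*-assoc (f 0) (∏ n (f ∘ suc)) (f (suc n)))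

-- Solves λ(j,j) = n - 2j and λ(j+1,i) = λ(j,i) + n - 2(j+1), the shifts made by
-- gram-zero and gram-suc.
gramEigenvalue : ℕ → ℕ → ℕ → ℤ
gramEigenvalue n j i = (ℤ.+ suc j - ℤ.+ i) * (ℤ.+ n - ℤ.+ j - ℤ.+ i)

-- Passing from level j to level j + 1 relates the two polynomials by w^C(n,j) and w^C(n,j+1), whose
-- quotient is the new factor. Cancelling needs w ≠ 0, and `w` is z minus the new eigenvalue; this
-- is why z must avoid the eigenvalues.
gram-∏ : ∀ n j z → 2 ℕ.* j ≤ n → (∀ i → i ≤ j → z - gramEigenvalue n j i ≢ 0ℤ) →
  gram n j z ≡ ∏ (suc j) λ i → (z - gramEigenvalue n j i) ℤ.^ mult n i
gram-∏ n zero z _ _ = begin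
  gram n 0 z                        ≡⟨ gram-zero n z ⟩
  (z - ι n) ^ᴿ length (level n 0)   ≡⟨ cong ((z - ι n) ^ᴿ_) (trans (length-level n 0) (nC0≡1 n)) ⟩
  (z - ι n) ^ᴿ 1                    ≡⟨ ^ᴿ≡^ (z - ι n) 1 ⟩
  (z - ι n) ℤ.^ 1                   ≡⟨ cong (λ t → (z - t) ℤ.^ 1) (ι≡+ n) ⟩
  (z - ℤ.+ n) ℤ.^ 1                 ≡⟨ cong (ℤ._^ 1) (arith z (ℤ.+ n)) ⟩
  (z - gramEigenvalue n 0 0) ℤ.^ 1  ≡⟨ ℤ.*-identityˡ _ ⟨
  1ℤ * (z - gramEigenvalue n 0 0) ℤ.^ 1 ∎
  where
  open ≡-Reasoning
  arith : ∀ z n → z - n ≡ z - (1ℤ - 0ℤ) * (n - 0ℤ - 0ℤ)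
  arith = ℤ.solve-∀
gram-∏ n (suc j) z 2j≤n z≢ = *-cancel-≢0 (w ℤ.^ (n C j)) {k = ∏ (suc (suc j)) λ i → (z - gramEigenvalue n (suc j) i) ℤ.^ mult n i}
  (^-≢0 w (n C j) λ w≡0 → z≢ (suc j) ℕ.≤-refl (trans (sym w≡) w≡0)) (begin
  w ℤ.^ (n C j) * gram n (suc j) z
    ≡⟨ cong (_* gram n (suc j) z) (power (length-level n j)) ⟨
  c′ ^ᴿ length (level n j) * gram n (suc j) z
    ≡⟨ gram-suc n j z ⟩
  c′ ^ᴿ length (level n (suc j)) * gram n j c′
    ≡⟨ cong₂ _*_ (power (length-level n (suc j))) (cong (gram n j) c′≡w) ⟩
  w ℤ.^ (n C suc j) * gram n j w
    ≡⟨ cong₂ _*_ (trans (cong (w ℤ.^_) (sym (C+mult n j 2j≤n))) (ℤ.^-distribˡ-+-* w (n C j) (mult n (suc j))))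
         (trans (gram-∏ n j w (ℕ.≤-trans (ℕ.*-monoʳ-≤ 2 (ℕ.n≤1+n j)) 2j≤n)
           (λ i i≤j eq → z≢ i (ℕ.m≤n⇒m≤1+n i≤j) (trans (sym (shift i)) eq)))
           (∏-cong (suc j) λ i _ → cong (ℤ._^ mult n i) (shift i))) ⟩
  w ℤ.^ (n C j) * w ℤ.^ mult n (suc j) * ∏ (suc j) (λ i → (z - gramEigenvalue n (suc j) i) ℤ.^ mult n i)
    ≡⟨ arith (w ℤ.^ (n C j)) (w ℤ.^ mult n (suc j)) _ ⟩
  w ℤ.^ (n C j) * (∏ (suc j) (λ i → (z - gramEigenvalue n (suc j) i) ℤ.^ mult n i) * w ℤ.^ mult n (suc j))
    ≡⟨ cong (λ t → w ℤ.^ (n C j) * (∏ (suc j) (λ i → (z - gramEigenvalue n (suc j) i) ℤ.^ mult n i) * t ℤ.^ mult n (suc j))) w≡ ⟩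
  w ℤ.^ (n C j) * ∏ (suc (suc j)) (λ i → (z - gramEigenvalue n (suc j) i) ℤ.^ mult n i) ∎)
  where
  open ≡-Reasoning
  c′ = z - (ι n - (ι (suc j) + ι (suc j)))
  w = z - (ℤ.+ n - (ℤ.+ suc j + ℤ.+ suc j))
  c′≡w : c′ ≡ w
  c′≡w = cong₂ (λ s t → z - (s - (t + t))) (ι≡+ n) (ι≡+ (suc j))
  power : ∀ {l m} → l ≡ m → c′ ^ᴿ l ≡ w ℤ.^ m
  power {l} refl = trans (^ᴿ≡^ c′ l) (cong (ℤ._^ l) c′≡w)
  w≡ : w ≡ z - gramEigenvalue n (suc j) (suc j)
  w≡ = lemma z (ℤ.+ n) (ℤ.+ suc j)
    where
    lemma : ∀ z n j → z - (n - (j + j)) ≡ z - (1ℤ + j - j) * (n - j - j)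
    lemma = ℤ.solve-∀
  shift : ∀ i → w - gramEigenvalue n j i ≡ z - gramEigenvalue n (suc j) i
  shift i = lemma z (ℤ.+ n) (ℤ.+ j) (ℤ.+ i)
    where
    lemma : ∀ z n j i → z - (n - ((1ℤ + j) + (1ℤ + j))) - ((1ℤ + j) - i) * (n - j - i)
      ≡ z - ((1ℤ + (1ℤ + j)) - i) * (n - (1ℤ + j) - i)
    lemma = ℤ.solve-∀
  arith : ∀ a b c → a * b * c ≡ a * (c * b)
  arith = ℤ.solve-∀

factor : ℤ → ℤ × ℤ → ℤ
factor x (θ , m) = (x - θ) ℤ.^ ℤ.∣ m ∣

splitting : ℤ → List (ℤ × ℤ) → ℤ
splitting x = foldr (λ θ s → factor x θ * s) 1ℤ

eval-splitting : ∀ θs x →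
  eval (productₚ (map (λ (θ , m) → (X +ₚ (-ₚ constₚ θ)) ^ₚ ℤ.∣ m ∣) θs)) x ≡ splitting x θs
eval-splitting []             x = eval-const 1ℤ x
eval-splitting ((θ , m) ∷ θs) x = trans (eval-* ((X +ₚ (-ₚ constₚ θ)) ^ₚ ℤ.∣ m ∣) _ x) (cong₂ _*_
  (trans (eval-^ (X +ₚ (-ₚ constₚ θ)) ℤ.∣ m ∣ x) (cong (ℤ._^ ℤ.∣ m ∣)
    (trans (eval-+ X (-ₚ constₚ θ) x) (cong₂ _+_ (eval-X x) (eval-const (- θ) x)))))
  (eval-splitting θs x))

splitting-++ : ∀ x θs φs → splitting x (θs ++ φs) ≡ splitting x θs * splitting x φs
splitting-++ x []       φs = sym (ℤ.*-identityˡ _)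
splitting-++ x (θ ∷ θs) φs = trans (cong (factor x θ *_) (splitting-++ x θs φs))
  (sym (ℤ.*-assoc (factor x θ) (splitting x θs) (splitting x φs)))

splitting-applyUpTo : ∀ x (h : ℕ → ℤ × ℤ) f n →
  splitting x (map h (applyUpTo f n)) ≡ ∏ n λ i → factor x (h (f i))
splitting-applyUpTo x h f zero    = refl
splitting-applyUpTo x h f (suc n) = trans (cong (factor x (h (f 0)) *_) (splitting-applyUpTo x h (f ∘ suc) n))
  (sym (∏-head n λ i → factor x (h (f i))))

open import Data.Integer.Base using (+_)

-- Adding 2 to both the variable and the matrix produces the Gram matrix of the incidence matrix, in
-- the form `lineGraph-gram` expects.
eval-charPoly : ∀ {m} (A : Matrix ℤ m) x →
  eval (charPoly A) x ≡ det λ i j → (x + + 2) * 𝟏 i j - (A i j + + 2 * 𝟏 i j)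
eval-charPoly A x = trans (eval-det (λ i j → (if does (i Fin.≟ j) then X else []) +ₚ (-ₚ constₚ (A i j))) x)
  (trans (sym (det≡ λ i j → eval ((if does (i Fin.≟ j) then X else []) +ₚ (-ₚ constₚ (A i j))) x))
  (det-cong λ i j → trans (eval-charMatrix A x i j) (arith x (𝟏 i j) (A i j))))
  where
  arith : ∀ x t a → x * t - a ≡ (x + + 2) * t - (a + + 2 * t)
  arith = ℤ.solve-∀

-- Summing degrees over the two layers counts every edge twice, and `absorption` shows that both
-- layers give the same total.
∣edges∣ : ∀ n j → length (edges (BLlayers n (suc j))) ≡ suc j ℕ.* (n C suc j)
∣edges∣ n j = ℤ.+-injective (ℤ.*-cancelʳ-≡ (+ e) (+ (suc j ℕ.* b)) (+ 2) (begin
  + e * + 2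
    ≡⟨ cong (_* (+ 2)) (ι≡+ e) ⟨
  ι e * + 2
    ≡⟨ Layers.edge-count ℤ.+-*-commutativeRing n j ⟩
  ι (length (level n j)) * (ι n - ι j) + ι (length (level n (suc j))) * ι (suc j)
    ≡⟨ cong₂ _+_ (cong₂ _*_ (trans (ι≡+ _) (cong +_ (length-level n j))) (cong₂ _-_ (ι≡+ n) (ι≡+ j)))
                 (cong₂ _*_ (trans (ι≡+ _) (cong +_ (length-level n (suc j)))) (ι≡+ (suc j))) ⟩
  + a * (+ n - + j) + + b * + suc j
    ≡⟨ arith₁ (+ a) (+ n) (+ j) (+ b) (+ suc j) ⟩
  (+ n * + a - + j * + a) + + suc j * + b
    ≡⟨ cong (λ t → (t - + j * + a) + + suc j * + b) absorptionℤ ⟨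
  ((+ suc j * + b + + j * + a) - + j * + a) + + suc j * + b
    ≡⟨ arith₂ (+ suc j * + b) (+ j * + a) ⟩
  (+ suc j * + b) * + 2
    ≡⟨ cong (_* (+ 2)) (ℤ.pos-* (suc j) b) ⟨
  + (suc j ℕ.* b) * + 2 ∎))
  where
  open ≡-Reasoning
  e = length (edges (BLlayers n (suc j)))
  a = n C j
  b = n C suc j
  arith₁ : ∀ a n j b k → a * (n - j) + b * k ≡ (n * a - j * a) + k * b
  arith₁ = ℤ.solve-∀
  arith₂ : ∀ s t → ((s + t) - t) + s ≡ s * + 2
  arith₂ = ℤ.solve-∀
  absorptionℤ : + suc j * + b + + j * + a ≡ + n * + a
  absorptionℤ = begin
    + suc j * + b + + j * + a           ≡⟨ cong₂ _+_ (ℤ.pos-* (suc j) b) (ℤ.pos-* j a) ⟨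
    + (suc j ℕ.* b) + + (j ℕ.* a)       ≡⟨ ℤ.pos-+ (suc j ℕ.* b) (j ℕ.* a) ⟨
    + (suc j ℕ.* b ℕ.+ j ℕ.* a)         ≡⟨ cong +_ (absorption n j) ⟩
    + (n ℕ.* a)                         ≡⟨ ℤ.pos-* n a ⟩
    + n * + a                           ∎

choose-difference : ∀ n i → 2 ℕ.* i ≤ n → choose n (+ i) - choose n (+ i - + 1) ≡ + mult n i
-- The lower index of the second term is -1 here, where `choose` is 0.
choose-difference n zero    _    = trans (ℤ.+-identityʳ _) (cong +_ (nC0≡1 n))
choose-difference n (suc i) 2i≤n = trans (ℤ.m-n≡m⊖n (n C suc i) (n C i)) (ℤ.⊖-≥ (ℕ.<⇒≤ (C-increasing n i 2i≤n)))

-- The multiplicity of -2.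
nullity : ℕ → ℕ → ℕ
nullity n k = suc (k ℕ.* (n C k)) ∸ suc n C k

-- Guards the truncated subtraction in `nullity`. This is where k ≥ 2 enters: C(n+1,k) ≤ 2 C(n,k) ≤
-- k C(n,k).
suc-C≤ : ∀ n j → 1 ≤ j → 2 ℕ.* suc j ≤ n → suc n C suc j ≤ suc j ℕ.* (n C suc j)
suc-C≤ n j 1≤j 2k≤n = begin
  suc n C suc j          ≡⟨ nCk+nC[k+1]≡[n+1]C[k+1] n j ⟨
  n C j ℕ.+ n C suc j    ≤⟨ ℕ.+-monoˡ-≤ (n C suc j) (ℕ.<⇒≤ (C-increasing n j 2k≤n)) ⟩
  n C suc j ℕ.+ n C suc j ≡⟨ cong (n C suc j ℕ.+_) (ℕ.+-identityʳ (n C suc j)) ⟨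
  2 ℕ.* (n C suc j)      ≤⟨ ℕ.*-monoˡ-≤ (n C suc j) (ℕ.s≤s 1≤j) ⟩
  suc j ℕ.* (n C suc j)  ∎
  where open ℕ.≤-Reasoning

nullity-formula : ∀ n j → 1 ≤ j → 2 ℕ.* suc j ≤ n →
  + suc j * choose n (+ suc j) - choose (suc n) (+ suc j) + + 1 ≡ + nullity n (suc j)
nullity-formula n j 1≤j 2k≤n = begin
  + suc j * + b - + c + + 1              ≡⟨ arith (+ suc j * + b) (+ c) ⟩
  (+ 1 + + suc j * + b) - + c            ≡⟨ cong (λ t → + 1 + t - + c) (ℤ.pos-* (suc j) b) ⟨
  + suc (suc j ℕ.* b) - + c              ≡⟨ ℤ.m-n≡m⊖n (suc (suc j ℕ.* b)) c ⟩
  suc (suc j ℕ.* b) ℤ.⊖ c                ≡⟨ ℤ.⊖-≥ (ℕ.m≤n⇒m≤1+n (suc-C≤ n j 1≤j 2k≤n)) ⟩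
  + nullity n (suc j)                    ∎
  where
  open ≡-Reasoning
  b = n C suc j
  c = suc n C suc j
  arith : ∀ s c → s - c + + 1 ≡ (+ 1 + s) - c
  arith = ℤ.solve-∀

-- The spectrum for fixed n and k = j + 1

module _ (j n : ℕ) (1≤j : 1 ≤ j) (2k≤n : 2 ℕ.* suc j ≤ n) where
  private
    k : ℕ
    k = suc j

    lowθ highθ : ℕ → ℤ × ℤ
    lowθ  i = + i - + 2 , choose n (+ i) - choose n (+ i - + 1)
    highθ i = + n - + 1 - + i , choose n (+ i) - choose n (+ i - + 1)

  spectrum : List (ℤ × ℤ)
  spectrum =
      (- (+ 2) , + k * choose n (+ k) - choose (suc n) (+ k) + + 1)
    ∷ map lowθ (applyUpTo suc j)
    ++ map highθ (upTo k)
    ++ lowθ k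
    ∷ []

  private
    2i≤n : ∀ {i} → i ≤ k → 2 ℕ.* i ≤ n
    2i≤n i≤k = ℕ.≤-trans (ℕ.*-monoʳ-≤ 2 i≤k) 2k≤n

    -- For x ≥ n the shifted variable x + 2 exceeds n + 1, hence also k and all i and n + 1 - i, so
    -- every power to be cancelled is nonzero.
    module Evaluation (x : ℕ) (n≤x : n ≤ x) where
      y : ℤ
      y = + x + + 2

      a b : ℕ
      a = length (level n j)
      b = length (level n k)

      low high : ℕ → ℤ
      low i  = (y - + i) ℤ.^ mult n i
      high i = (y - (+ n + + 1 - + i)) ℤ.^ mult n i

      D : ℤ
      D = eval (charPoly (adjacencyMatrix (lineGraph (BLlayers n k)))) (+ x)

      w : ℤ
      w = y - + k

      y-m≢0 : ∀ {m} → m ≤ suc n → y - + m ≢ 0ℤ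
      y-m≢0 {m} m≤ eq = ℕ.<⇒≢ (ℕ.≤-<-trans m≤ (ℕ.≤-trans (ℕ.s≤s (ℕ.s≤s n≤x)) (ℕ.≤-reflexive (ℕ.+-comm 2 x))))
        (ℤ.+-injective (sym (ℤ.i-j≡0⇒i≡j y (+ m) eq)))

      y≢0 : y ≢ 0ℤ
      y≢0 = y-m≢0 ℕ.z≤n ∘ trans (ℤ.+-identityʳ y)

      k≤n : k ≤ n
      k≤n = ℕ.≤-trans (ℕ.m≤n*m k 2) 2k≤n

      z : ℤ
      z = w * (y - (+ n - + j))

      -- As a quadratic in y, the left side has i as a root, and its roots add up to k + (n - j) = n
      -- + 1. Undoing the shift by 2 yields the eigenvalues i - 2 and n - 1 - i.
      z-eigenvalue : ∀ i → z - gramEigenvalue n j i ≡ (y - + i) * (y - (+ n + + 1 - + i))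
      z-eigenvalue i = arith y (+ j) (+ n) (+ i)
        where
        arith : ∀ y j n i → (y - (+ 1 + j)) * (y - (n - j)) - (+ 1 + j - i) * (n - j - i)
          ≡ (y - i) * (y - (n + + 1 - i))
        arith = ℤ.solve-∀

      n+1-i : ∀ {i} → i ≤ suc n → + n + + 1 - + i ≡ + (suc n ∸ i)
      n+1-i {i} i≤ = trans (cong (λ t → + t - + i) (ℕ.+-comm n 1)) (trans (ℤ.m-n≡m⊖n (suc n) i) (ℤ.⊖-≥ i≤))

      z≢ : ∀ i → i ≤ j → z - gramEigenvalue n j i ≢ 0ℤ
      z≢ i i≤j eq with ℤ.i*j≡0⇒i≡0∨j≡0 (y - + i) (trans (sym (z-eigenvalue i)) eq)
      ... | inj₁ eq₁ = y-m≢0 i≤1+n eq₁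
        where
        i≤1+n : i ≤ suc n
        i≤1+n = ℕ.≤-trans i≤j (ℕ.≤-trans (ℕ.n≤1+n j) (ℕ.m≤n⇒m≤1+n k≤n))
      ... | inj₂ eq₂ = y-m≢0 (ℕ.m∸n≤m (suc n) i) (trans (cong (_-_ y) (sym (n+1-i i≤1+n))) eq₂)
        where
        i≤1+n : i ≤ suc n
        i≤1+n = ℕ.≤-trans i≤j (ℕ.≤-trans (ℕ.n≤1+n j) (ℕ.m≤n⇒m≤1+n k≤n))

      -- The low factor of index 0 is just `y`; it is set apart because it belongs to the eigenvalue
      -- -2.
      gram≡ : gram n j z ≡ (y * ∏ j (low ∘ suc)) * ∏ k high
      gram≡ = begin
        gram n j z
          ≡⟨ gram-∏ n j z (2i≤n (ℕ.n≤1+n j)) z≢ ⟩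
        ∏ k (λ i → (z - gramEigenvalue n j i) ℤ.^ mult n i)
          ≡⟨ ∏-cong k (λ i _ → trans (cong (ℤ._^ mult n i) (z-eigenvalue i)) (*-^ (y - + i) (y - (+ n + + 1 - + i)) (mult n i))) ⟩
        ∏ k (λ i → low i * high i)
          ≡⟨ ∏-* k low high ⟩
        ∏ k low * ∏ k high
          ≡⟨ cong (_* ∏ k high) (trans (∏-head j low) (cong (_* ∏ j (low ∘ suc)) (arith y))) ⟩
        (y * ∏ j (low ∘ suc)) * ∏ k high ∎
        where
        open ≡-Reasoning
        arith : ∀ y → (y - 0ℤ) * 1ℤ ≡ y
        arith = ℤ.solve-∀

      a+b≡ : a ℕ.+ b ≡ suc n C k
      a+b≡ = trans (cong₂ ℕ._+_ (length-level n j) (length-level n k)) (nCk+nC[k+1]≡[n+1]C[k+1] n j)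

      b≡ : b ≡ a ℕ.+ mult n k
      b≡ = trans (length-level n k) (trans (sym (C+mult n j 2k≤n)) (cong (ℕ._+ mult n k) (sym (length-level n j))))

      -- The successor is the extra `y` from `gram≡`: what exceeds the number of vertices in the
      -- total exponent of y is the multiplicity of -2.
      suc-edges : suc (length (edges (BLlayers n k))) ≡ (a ℕ.+ b) ℕ.+ nullity n k
      suc-edges = trans (cong suc (∣edges∣ n j)) (trans
        (sym (ℕ.m+[n∸m]≡n (ℕ.m≤n⇒m≤1+n (suc-C≤ n j 1≤j 2k≤n))))
        (cong (ℕ._+ nullity n k) (sym a+b≡)))

      reduction : y ℤ.^ (a ℕ.+ b) * (w ℤ.^ a * D) ≡ y ℤ.^ length (edges (BLlayers n k)) * (w ℤ.^ b * gram n j z)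
      reduction = begin
        y ℤ.^ (a ℕ.+ b) * (w ℤ.^ a * D)
          ≡⟨ cong₂ _*_ (^ᴿ≡^ y (a ℕ.+ b)) (cong₂ _*_ (trans (cong (λ t → (y - t) ^ᴿ a) (ι≡+ k)) (^ᴿ≡^ w a))
               (sym (eval-charPoly (adjacencyMatrix (lineGraph (BLlayers n k))) (+ x)))) ⟨
        _ ≡⟨ Layers.lineGraph-gram ℤ.+-*-commutativeRing n j y ⟩
        _ ≡⟨ cong₂ _*_ (^ᴿ≡^ y (length (edges (BLlayers n k)))) (cong₂ _*_
               (trans (cong (λ t → (y - t) ^ᴿ b) (ι≡+ k)) (^ᴿ≡^ w b))
               (cong (gram n j) (trans (cong (λ t → (y - t) * (y - (ι n - ι j))) (ι≡+ k))
                 (cong₂ (λ s t → w * (y - (s - t))) (ι≡+ n) (ι≡+ j))))) ⟩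
        y ℤ.^ length (edges (BLlayers n k)) * (w ℤ.^ b * gram n j z) ∎
        where open ≡-Reasoning

      -- The final cancellation, for arbitrary integers so that determinants and powers remain atoms
      -- for the solver. The powers of y and of y - k to be removed are `u` and `v`; `e`, `q`, `p`,
      -- `t` are the four groups of factors in the order of `spectrum`.
      assemble : ∀ u v t e q p yE w^b g d → u ≢ 0ℤ → v ≢ 0ℤ →
        y * yE ≡ u * e → w^b ≡ v * t → g ≡ (y * q) * p → u * (v * d) ≡ yE * (w^b * g) → d ≡ e * (q * (p * (t * 1ℤ)))
      assemble u v t e q p yE w^b g d u≢0 v≢0 yE≡ w^b≡ g≡ eq =
        *-cancel-≢0 v v≢0 (*-cancel-≢0 u u≢0 (begin
          u * (v * d)                           ≡⟨ eq ⟩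
          yE * (w^b * g)                        ≡⟨ cong₂ (λ s r → yE * (s * r)) w^b≡ g≡ ⟩
          yE * ((v * t) * ((y * q) * p))        ≡⟨ arith₁ yE v t y q p ⟩
          (y * yE) * (v * (q * (p * (t * 1ℤ)))) ≡⟨ cong (_* (v * (q * (p * (t * 1ℤ))))) yE≡ ⟩
          (u * e) * (v * (q * (p * (t * 1ℤ))))  ≡⟨ arith₂ u e v (q * (p * (t * 1ℤ))) ⟩
          u * (v * (e * (q * (p * (t * 1ℤ)))))  ∎))
        where
        open ≡-Reasoning
        arith₁ : ∀ yE v t y q p → yE * ((v * t) * ((y * q) * p)) ≡ (y * yE) * (v * (q * (p * (t * 1ℤ))))
        arith₁ = ℤ.solve-∀
        arith₂ : ∀ u e v r → (u * e) * (v * r) ≡ u * (v * (e * r))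
        arith₂ = ℤ.solve-∀

      D≡ : D ≡ y ℤ.^ nullity n k * (∏ j (low ∘ suc) * (∏ k high * (w ℤ.^ mult n k * 1ℤ)))
      D≡ = assemble (y ℤ.^ (a ℕ.+ b)) (w ℤ.^ a) (w ℤ.^ mult n k) (y ℤ.^ nullity n k)
        (∏ j (low ∘ suc)) (∏ k high) (y ℤ.^ length (edges (BLlayers n k))) (w ℤ.^ b) (gram n j z) D
        (^-≢0 y (a ℕ.+ b) y≢0) (^-≢0 w a (y-m≢0 (ℕ.m≤n⇒m≤1+n k≤n)))
        (trans (cong (y ℤ.^_) suc-edges) (ℤ.^-distribˡ-+-* y (a ℕ.+ b) (nullity n k)))
        (trans (cong (w ℤ.^_) b≡) (ℤ.^-distribˡ-+-* w a (mult n k)))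
        gram≡ reduction

      factor-low : ∀ i → i ≤ k → factor (+ x) (lowθ i) ≡ low i
      factor-low i i≤k = cong₂ ℤ._^_ (arith (+ x) (+ i)) (cong ℤ.∣_∣ (choose-difference n i (2i≤n i≤k)))
        where
        arith : ∀ x i → x - (i - + 2) ≡ x + + 2 - i
        arith = ℤ.solve-∀

      factor-high : ∀ i → i ≤ k → factor (+ x) (highθ i) ≡ high i
      factor-high i i≤k = cong₂ ℤ._^_ (arith (+ x) (+ n) (+ i)) (cong ℤ.∣_∣ (choose-difference n i (2i≤n i≤k)))
        where
        arith : ∀ x n i → x - (n - + 1 - i) ≡ x + + 2 - (n + + 1 - i)
        arith = ℤ.solve-∀

      splitting≡ : splitting (+ x) spectrum ≡ y ℤ.^ nullity n k * (∏ j (low ∘ suc) * (∏ k high * (w ℤ.^ mult n k * 1ℤ)))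
      splitting≡ = cong₂ _*_ (cong (y ℤ.^_) (cong ℤ.∣_∣ (nullity-formula n j 1≤j 2k≤n))) (trans
        (splitting-++ (+ x) (map lowθ (applyUpTo suc j)) (map highθ (upTo k) ++ lowθ k ∷ []))
        (cong₂ _*_
          (trans (splitting-applyUpTo (+ x) lowθ suc j) (∏-cong j λ i i<j → factor-low (suc i) (ℕ.m≤n⇒m≤1+n i<j)))
          (trans (splitting-++ (+ x) (map highθ (upTo k)) (lowθ k ∷ []))
            (cong₂ _*_
              (trans (splitting-applyUpTo (+ x) highθ id k) (∏-cong k λ i i<k → factor-high i (ℕ.<⇒≤ i<k)))
              (cong (_* 1ℤ) (factor-low k ℕ.≤-refl))))))

  spectrum-splits : charPoly (adjacencyMatrix (lineGraph (BLlayers n k)))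
    ≈ₚ productₚ (map (λ (θ , m) → (X +ₚ (-ₚ constₚ θ)) ^ₚ ℤ.∣ m ∣) spectrum)
  spectrum-splits = eval-injective (charPoly (adjacencyMatrix (lineGraph (BLlayers n k))))
    (productₚ (map (λ (θ , m) → (X +ₚ (-ₚ constₚ θ)) ^ₚ ℤ.∣ m ∣) spectrum)) n λ x n≤x →
    trans (Evaluation.D≡ x n≤x) (sym (trans (eval-splitting spectrum (+ x)) (Evaluation.splitting≡ x n≤x)))

  spectrum-positive : All (λ (_ , m) → 0ℤ ℤ.< m) spectrum
  spectrum-positive =
    subst (0ℤ ℤ.<_) (sym (nullity-formula n j 1≤j 2k≤n)) (ℤ.+<+ (ℕ.m<n⇒0<n∸m (ℕ.s≤s (suc-C≤ n j 1≤j 2k≤n))))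
    All.∷ All.++⁺ (All.map⁺ (All.applyUpTo⁺₁ suc j λ i<j → positive (ℕ.m≤n⇒m≤1+n i<j)))
      (All.++⁺ (All.map⁺ (All.applyUpTo⁺₁ id k λ i<k → positive (ℕ.<⇒≤ i<k)))
        (positive ℕ.≤-refl All.∷ All.[]))
    where
    positive : ∀ {i} → i ≤ k → 0ℤ ℤ.< choose n (+ i) - choose n (+ i - + 1)
    positive {i} i≤k = subst (0ℤ ℤ.<_) (sym (choose-difference n i (2i≤n i≤k)))
      (ℤ.+<+ (mult-positive n i (2i≤n i≤k)))

  -- The values -2 and k - 2 are the low values of index 0 and k, so three comparisons suffice. A
  -- low value of index i equals a high value of index i′ only if i + i′ = n + 1, whereas here i +
  -- i′ < 2k ≤ n.
  spectrum-distinct : AllPairs _≢_ (map proj₁ spectrum)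
  spectrum-distinct = AllPairs.map⁺ {xs = spectrum} (
    All.++⁺ (All.map⁺ (All.applyUpTo⁺₁ suc j λ {i} _ → low≢low {0} {suc i} λ ()))
      (All.++⁺ (All.map⁺ (All.applyUpTo⁺₁ id k λ {i} i<k → low≢high {0} {i} (ℕ.<-≤-trans i<k k≤n)))
        (low≢low {0} {k} (λ ()) All.∷ All.[]))
    AllPairs.∷ AllPairs.++⁺
      (AllPairs.map⁺ (AllPairs.applyUpTo⁺₁ suc j λ i<i′ _ → low≢low (ℕ.<⇒≢ (ℕ.s≤s i<i′))))
      (AllPairs.++⁺ (AllPairs.map⁺ (AllPairs.applyUpTo⁺₁ id k λ i<i′ _ → high≢high (ℕ.<⇒≢ i<i′)))
        (All.[] AllPairs.∷ AllPairs.[])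
        (All.map⁺ (All.applyUpTo⁺₁ id k λ i<k → (low≢high (sum<n ℕ.≤-refl i<k) ∘ sym) All.∷ All.[])))
      (All.map⁺ (All.applyUpTo⁺₁ suc j λ i<j → All.++⁺
        (All.map⁺ (All.applyUpTo⁺₁ id k λ i<k → low≢high (sum<n (ℕ.m≤n⇒m≤1+n i<j) i<k)))
        (low≢low (ℕ.<⇒≢ (ℕ.s≤s i<j)) All.∷ All.[]))))
    where
    k≤n : k ≤ n
    k≤n = ℕ.≤-trans (ℕ.m≤n*m k 2) 2k≤n
    low≢low : ∀ {i i′} → i ≢ i′ → + i - + 2 ≢ + i′ - + 2
    low≢low {i} {i′} i≢i′ eq = i≢i′ (ℤ.+-injective (trans (arith (+ i)) (trans (cong (_+ (+ 2)) eq) (sym (arith (+ i′))))))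
      where
      arith : ∀ i → i ≡ i - + 2 + + 2
      arith = ℤ.solve-∀
    high≢high : ∀ {i i′} → i ≢ i′ → + n - + 1 - + i ≢ + n - + 1 - + i′
    high≢high {i} {i′} i≢i′ eq = i≢i′ (ℤ.+-injective
      (trans (arith (+ n) (+ i)) (trans (cong (λ t → + n - + 1 - t) eq) (sym (arith (+ n) (+ i′))))))
      where
      arith : ∀ n i → i ≡ n - + 1 - (n - + 1 - i)
      arith = ℤ.solve-∀
    low≢high : ∀ {i i′} → i ℕ.+ i′ < n → + i - + 2 ≢ + n - + 1 - + i′
    low≢high {i} {i′} i+i′<n eq = ℕ.<⇒≢ (ℕ.m<n⇒m<1+n i+i′<n) (ℤ.+-injective (trans
      (arith₁ (+ i) (+ i′)) (trans (cong (λ t → t + + i′ + + 2) eq) (arith₂ (+ n) (+ i′)))))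
      where
      arith₁ : ∀ i i′ → i + i′ ≡ i - + 2 + i′ + + 2
      arith₁ = ℤ.solve-∀
      arith₂ : ∀ n i → n - + 1 - i + i + + 2 ≡ + 1 + n
      arith₂ = ℤ.solve-∀
    sum<n : ∀ {i i′} → i ≤ k → i′ < k → i ℕ.+ i′ < n
    sum<n i≤k i′<k = ℕ.<-≤-trans (ℕ.+-mono-≤-< i≤k i′<k)
      (ℕ.≤-trans (ℕ.≤-reflexive (cong (k ℕ.+_) (sym (ℕ.+-identityʳ k)))) 2k≤n)

theorem3p2 : (k n : ℕ) → 2 ≤ k → 2 ℕ.* k ≤ n →
    HasSpectrum (lineGraph (BLlayers n k))
    ( (- (+ 2) , + k * choose n (+ k) - choose (suc n) (+ k) + + 1)
    ∷ map (λ j → + j - + 2 , choose n (+ j) - choose n (+ j - + 1)) (applyUpTo suc (k ∸ 1))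
    ++ map (λ j → + n - + 1 - + j , choose n (+ j) - choose n (+ j - + 1)) (upTo k)
    ++ (+ k - + 2 , choose n (+ k) - choose n (+ k - + 1))
    ∷ [] )
-- Matching on k = j + 1 makes k ∸ 1 compute to j, after which the stated list is `spectrum` by
-- computation.
theorem3p2 (suc j) n (ℕ.s≤s 1≤j) 2k≤n = record
  { distinct = spectrum-distinct j n 1≤j 2k≤n
  ; positive = spectrum-positive j n 1≤j 2k≤n
  ; splits   = spectrum-splits j n 1≤j 2k≤n
  }
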